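{- Let $d$ be the degree sequence of a graph. The realization graph $\mathscr{G}(d)$ is a hypercube if and only if $d$ is the degree sequence of a graph that is both split and $P_4$-reducible.
   Context: All graphs are finite and simple. For a degree sequence $d=(d_1,\dots,d_n)$, a realization of $d$ is a graph with vertex set $\{1,\dots,n\}$ in which vertex $i$ has degree $d_i$ (realizations are distinguished by edge sets). A 2-switch replaces edges $ab,cd$ by $ad,bc$, where $a,b,c,d$ are distinct vertices, $ab,cd$ are edges and $ad,bc$ are non-edges. The realization graph $\mathscr{G}(d)$ has the realizations of $d$ as vertices, two being adjacent iff one is obtained from the other by a single 2-switch. A hypercube is a graph whose vertices can be identified with all $(0,1)$-vectors of some fixed length $m\ge 0$ so that two vertices are adjacent iff their vectors differ in exactly one coordinate (so $K_1$ and $K_2$ are hypercubes). A split graph is a graph whose vertex set can be partitioned into a clique and an independent set. A graph is $P_4$-reducible if each of its vertices belongs to at most one induced path on four vertices. -}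

module Defs where

open import Data.Nat using (ℕ; zero; suc)
open import Data.Bool using (Bool; true; false; if_then_else_)
open import Data.Fin using (Fin)
open import Data.Vec using (Vec; lookup; tabulate; sum)
open import Data.Product using (Σ; ∃; ∃-syntax; _×_; _,_)
open import Data.Sum using (_⊎_)
open import Relation.Nullary using (¬_)
open import Relation.Binary.PropositionalEquality using (_≡_; _≢_)
open import Function.Bundles using (_⇔_)

record Graph (n : ℕ) : Set where
  field
    E      : Fin n → Fin n → Bool
    sym    : ∀ i j → E i j ≡ E j i
    irrefl : ∀ i → E i i ≡ false
open Graph public

_≈E_ : ∀ {n} → Graph n → Graph n → Set
G ≈E H = ∀ i j → E G i j ≡ E H i j

deg : ∀ {n} → Graph n → Fin n → ℕ
deg G i = sum (tabulate (λ j → if E G i j then 1 else 0))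

record Realization {n : ℕ} (d : Vec ℕ n) : Set where
  field
    graph  : Graph n
    degree : ∀ i → deg graph i ≡ lookup d i
open Realization public

Graphic : ∀ {n} → Vec ℕ n → Set
Graphic d = Realization d

_≈R_ : ∀ {n} {d : Vec ℕ n} → Realization d → Realization d → Set
R ≈R S = graph R ≈E graph S

SamePair : ∀ {n} → Fin n → Fin n → Fin n → Fin n → Set
SamePair i j x y = (i ≡ x × j ≡ y) ⊎ (i ≡ y × j ≡ x)

TwoSwitch : ∀ {n} → Graph n → Graph n → Set
TwoSwitch {n} G H =
  ∃[ a ] ∃[ b ] ∃[ c ] ∃[ d ]
    (a ≢ b × a ≢ c × a ≢ d × b ≢ c × b ≢ d × c ≢ d)
  × (E G a b ≡ true × E G c d ≡ true × E G a d ≡ false × E G b c ≡ false)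
  × (∀ i j → SamePair i j a b → E H i j ≡ false)
  × (∀ i j → SamePair i j c d → E H i j ≡ false)
  × (∀ i j → SamePair i j a d → E H i j ≡ true)
  × (∀ i j → SamePair i j b c → E H i j ≡ true)
  × (∀ i j → ¬ SamePair i j a b → ¬ SamePair i j c d
           → ¬ SamePair i j a d → ¬ SamePair i j b c
           → E H i j ≡ E G i j)

AdjR : ∀ {n} {d : Vec ℕ n} → Realization d → Realization d → Set
AdjR R S = TwoSwitch (graph R) (graph S) ⊎ TwoSwitch (graph S) (graph R)

DifferInOne : ∀ {m} → Vec Bool m → Vec Bool m → Set
DifferInOne {m} u v =
  ∃[ k ] (lookup u k ≢ lookup v k × (∀ k' → k' ≢ k → lookup u k' ≡ lookup v k'))

IsHypercube : (V : Set) → (V → V → Set) → (V → V → Set) → Set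
IsHypercube V _≈_ Adj =
  ∃[ m ] Σ (V → Vec Bool m) λ φ →
      (∀ x y → x ≈ y → φ x ≡ φ y)
    × (∀ x y → φ x ≡ φ y → x ≈ y)
    × (∀ v → ∃[ x ] φ x ≡ v)
    × (∀ x y → Adj x y ⇔ DifferInOne (φ x) (φ y))

IsSplit : ∀ {n} → Graph n → Set
IsSplit {n} G = Σ (Fin n → Bool) λ K →
    (∀ i j → i ≢ j → K i ≡ true → K j ≡ true → E G i j ≡ true)
  × (∀ i j → K i ≡ false → K j ≡ false → E G i j ≡ false)

InducedP4 : ∀ {n} → Graph n → Fin n → Fin n → Fin n → Fin n → Set
InducedP4 G a b c d =
    (a ≢ b × a ≢ c × a ≢ d × b ≢ c × b ≢ d × c ≢ d)
  × (E G a b ≡ true × E G b c ≡ true × E G c d ≡ true)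
  × (E G a c ≡ false × E G b d ≡ false × E G a d ≡ false)

In4 : ∀ {n} → Fin n → Fin n → Fin n → Fin n → Fin n → Set
In4 x a b c d = x ≡ a ⊎ x ≡ b ⊎ x ≡ c ⊎ x ≡ d

-- P4-reducible: every vertex lies in at most one induced P4 (induced
-- subgraphs being identified with their vertex sets)
IsP4Reducible : ∀ {n} → Graph n → Set
IsP4Reducible {n} G =
  ∀ (v a b c d a' b' c' d' : Fin n) →
    InducedP4 G a b c d → In4 v a b c d →
    InducedP4 G a' b' c' d' → In4 v a' b' c' d' →
    ∀ x → (In4 x a b c d → In4 x a' b' c' d') × (In4 x a' b' c' d' → In4 x a b c d)

{-# OPTIONS --safe #-}

-- A hypercube contains neither a triangle nor a K₂,₃.  If b has two neighbours
-- that d lacks while d has one that b lacks, or if a realization contains an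
-- induced 2K₂ or C₄, three realizations are pairwise adjacent; an induced C₅,
-- and a 3K₂ or C₆ between the two sides of a split graph, produce K₂,₃'s.
-- The absence of 2K₂, C₄ and C₅ makes every realization split, and the absence
-- of the other configurations makes induced paths on four vertices disjoint.
--
-- Conversely, let G be split and P₄-reducible.  No vertex outside an
-- induced path a – b – c – d distinguishes b from c, so the 2-switch on the
-- path amounts to exchanging the labels b and c, and the switches on distinct
-- paths are independent.  Recording for every path whether ab is
-- an edge identifies the realizations with 0-1 vectors: if H is another
-- realization, a clique vertex of least degree at which G and H differ lies on
-- an induced path of G all of whose switchable pairs differ in H.
module Submission where

open import Defs
open import Data.Nat using (ℕ; zero; suc; _+_; _≤_; _<_; z≤n; s≤s)
open import Data.Nat.Properties using (+-0-commutativeMonoid; +-assoc; +-cancelʳ-<; +-cancelʳ-≡; +-comm; +-identityʳ; +-mono-<-≤; +-mono-≤; +-mono-≤-<; +-monoʳ-<; +-monoʳ-≤; +-monoˡ-≤; +-suc; <-irrefl; <-≤-trans; <⇒≱; _≤?_; m<m+n; m≤m+n; m≤n+m; ≤-<-connex; ≤-pred; ≤-refl; ≤-reflexive; ≤-trans; ≮⇒≥; module ≤-Reasoning)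
open import Data.Nat.Solver using (module +-*-Solver)
open import Data.Bool using (Bool; true; false; if_then_else_; not; _∧_)
import Data.Bool.Properties as Bool
open import Data.Fin using (Fin; zero; suc)
import Data.Fin as Fin
open import Data.Fin.Patterns using (0F; 1F; 2F; 3F; 4F; 5F)
open import Data.Fin.Properties using (_≟_; any?; all?)
import Data.Fin.Properties as Fin
open import Data.Fin.Permutation using (permutation)
open import Data.Fin.Permutation.Components using (transpose)
open import Data.List using (List; []; _∷_; allFin)
open import Data.List.Membership.Propositional using (_∈_)
open import Data.List.Membership.Propositional.Properties using (∈-allFin)
open import Data.List.Relation.Unary.Any using (here; there)
open import Data.Maybe using (Maybe; just; nothing; fromMaybe)
import Data.Maybe.Properties as Maybe
open import Data.Vec using (Vec; []; _∷_; lookup; tabulate)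
import Data.Vec as Vec
open import Data.Vec.Properties using (tabulate∘lookup; tabulate-cong; lookup∘tabulate)
open import Data.Vec.Relation.Unary.AllPairs using ([]; _∷_)
open import Data.Vec.Relation.Unary.All using (All; []; _∷_)
import Data.Vec.Relation.Unary.All as All
open import Data.Vec.Relation.Unary.Unique.Propositional using (Unique)
open import Data.Vec.Relation.Unary.Unique.Propositional.Properties using (lookup-injective)
open import Data.Vec.Relation.Binary.Pointwise.Inductive using (Pointwise; []; _∷_)
open import Data.Product using (Σ; ∃; ∃-syntax; _×_; _,_; proj₁; proj₂)
open import Data.Sum using (_⊎_; inj₁; inj₂; [_,_]′)
open import Data.Empty using (⊥; ⊥-elim)
open import Function using (_∘_; id; Equivalence)
open import Function.Bundles using (_⇔_; mk⇔)
open import Relation.Nullary using (¬_; Dec; yes; no; contradiction)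
open import Relation.Nullary.Decidable using (True; toWitness; from-yes; dec-true; dec-false; _×-dec_; _⊎-dec_; ¬?)
open import Relation.Unary using (Decidable)
open import Relation.Binary using (tri<; tri≈; tri>)
open import Relation.Binary.PropositionalEquality using (_≡_; _≢_; refl; trans; cong; cong₂; subst; subst₂; ≢-sym; module ≡-Reasoning)
import Relation.Binary.PropositionalEquality as ≡
open import Algebra.Properties.CommutativeMonoid.Sum +-0-commutativeMonoid using (sum; sum-cong-≗; sum-permute; sum-replicate-zero; ∑-comm; ∑-distrib-+)

-- In a split graph the inner vertices of an induced path on four vertices are clique vertices and
-- its ends independent ones. P₄-reducibility therefore becomes a statement about equality of
-- directed paths: one inner vertex, or one end, determines the path (`SameMid`, `SameEnd`). The
-- converse has to control all realizations, although only one of them is known to be P₄-reducible.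
-- The invariant `Good` survives the exchange of inner vertices, so every 0-1 vector is attained by
-- a good realization. The comparison of two realizations with equal vectors asks that only one of
-- them be good; hence an arbitrary realization coincides with a good one and is good itself. The
-- clique vertex in that comparison is chosen of least degree because this forces the vertex
-- replacing it to have a private neighbour, the fourth vertex of a path. Both inner vertices of a
-- path have the same degree, so the argument can be run again from the other one.

true≢false : ∀ {b} → b ≡ true → b ≡ false → ⊥
true≢false refl ()

not-true : ∀ {b} → b ≢ true → b ≡ false
not-true = Bool.¬-not

not-false : ∀ {b} → b ≢ false → b ≡ true
not-false = Bool.¬-not

-- Finite sums

sum-mono-≤ : ∀ {n} (f g : Fin n → ℕ) → (∀ i → f i ≤ g i) → sum f ≤ sum g
sum-mono-≤ {zero}  f g f≤g = z≤n
sum-mono-≤ {suc n} f g f≤g = +-mono-≤ (f≤g zero) (sum-mono-≤ (f ∘ suc) (g ∘ suc) (f≤g ∘ suc))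

sum-mono-< : ∀ {n} (f g : Fin n → ℕ) → (∀ i → f i ≤ g i) → ∀ i → f i < g i → sum f < sum g
sum-mono-< f g f≤g zero    f<g = +-mono-<-≤ f<g (sum-mono-≤ (f ∘ suc) (g ∘ suc) (f≤g ∘ suc))
sum-mono-< f g f≤g (suc i) f<g = +-mono-≤-< (f≤g zero) (sum-mono-< (f ∘ suc) (g ∘ suc) (f≤g ∘ suc) i f<g)

-- The crosswise form avoids truncated subtraction.
sum-update : ∀ {n} (f g : Fin n → ℕ) i → (∀ j → j ≢ i → f j ≡ g j) → sum f + g i ≡ sum g + f i
sum-update {suc n} f g zero f≗g = begin
  f zero + sum (f ∘ suc) + g zero ≡⟨ cong (λ s → f zero + s + g zero) (sum-cong-≗ (λ j → f≗g (suc j) λ ())) ⟩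
  f zero + sum (g ∘ suc) + g zero ≡⟨ +-comm _ (g zero) ⟩
  g zero + (f zero + sum (g ∘ suc)) ≡⟨ cong (g zero +_) (+-comm (f zero) _) ⟩
  g zero + (sum (g ∘ suc) + f zero) ≡⟨ +-assoc (g zero) _ _ ⟨
  g zero + sum (g ∘ suc) + f zero ∎
  where open ≡-Reasoning
sum-update {suc n} f g (suc i) f≗g = begin
  f zero + sum (f ∘ suc) + g (suc i)   ≡⟨ +-assoc (f zero) _ _ ⟩
  f zero + (sum (f ∘ suc) + g (suc i)) ≡⟨ cong₂ _+_ (f≗g zero λ ()) (sum-update (f ∘ suc) (g ∘ suc) i λ j j≢i → f≗g (suc j) λ { refl → j≢i refl }) ⟩
  g zero + (sum (g ∘ suc) + f (suc i)) ≡⟨ +-assoc (g zero) _ _ ⟨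
  g zero + sum (g ∘ suc) + f (suc i) ∎
  where open ≡-Reasoning

sum-involution : ∀ {n} (f : Fin n → ℕ) (σ : Fin n → Fin n) → (∀ i → σ (σ i) ≡ i) → sum f ≡ sum (f ∘ σ)
sum-involution f σ σσ = sum-permute f (permutation σ σ σσ σσ)

sum-tabulate : ∀ {n} (f : Fin n → ℕ) → Vec.sum (tabulate f) ≡ sum f
sum-tabulate {zero}  f = refl
sum-tabulate {suc n} f = cong (f zero +_) (sum-tabulate (f ∘ suc))

⟦_⟧ : Bool → ℕ
⟦ b ⟧ = if b then 1 else 0

⟦⟧≤1 : ∀ b → ⟦ b ⟧ ≤ 1
⟦⟧≤1 true  = ≤-refl
⟦⟧≤1 false = z≤n

count : ∀ {n} → (Fin n → Bool) → ℕ
count f = sum (⟦_⟧ ∘ f)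

count-≤ : ∀ {n} (f : Fin n → Bool) → count f ≤ n
count-≤ {zero}  f = z≤n
count-≤ {suc n} f = +-mono-≤ (⟦⟧≤1 (f zero)) (count-≤ (f ∘ suc))

-- Without such a `z` the set `g` would lie inside `f` and miss `x`, so it would be smaller. This is
-- how comparisons of degrees produce vertices later on.
count-exchange : ∀ {n} (f g : Fin n → Bool) → count f ≤ count g →
  ∀ x → f x ≡ true → g x ≡ false → ∃[ z ] (f z ≡ false × g z ≡ true)
count-exchange f g f≤g x fx gx with any? (λ z → f z Bool.≟ false ×-dec g z Bool.≟ true)
... | yes found = found
... | no  none  = contradiction f≤g (<⇒≱ (sum-mono-< _ _ g≤f x strict))
  where
  g≤f : ∀ z → ⟦ g z ⟧ ≤ ⟦ f z ⟧
  g≤f z with f z in fz | g z in gz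
  ... | true  | b     = ⟦⟧≤1 b
  ... | false | false = z≤n
  ... | false | true  = contradiction (z , fz , gz) none
  strict : ⟦ g x ⟧ < ⟦ f x ⟧
  strict rewrite fx | gx = ≤-refl

-- Transpositions of two vertices

module _ {n : ℕ} (p q : Fin n) where

  transpose-l : transpose p q p ≡ q
  transpose-l rewrite dec-true (p ≟ p) refl = refl

  transpose-r : transpose p q q ≡ p
  transpose-r with q ≟ p
  ... | yes refl = refl
  ... | no  _ rewrite dec-true (q ≟ q) refl = refl

  transpose-fix : ∀ {k} → k ≢ p → k ≢ q → transpose p q k ≡ k
  transpose-fix {k} k≢p k≢q rewrite dec-false (k ≟ p) k≢p | dec-false (k ≟ q) k≢q = refl

  transpose-elim : ∀ {ℓ} (P : Fin n → Fin n → Set ℓ) → P p q → P q p →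
    (∀ k → k ≢ p → k ≢ q → P k k) → ∀ k → P k (transpose p q k)
  transpose-elim P Pp Pq Pk k = by-cases (k ≟ p) (k ≟ q)
    where
    by-cases : Dec (k ≡ p) → Dec (k ≡ q) → P k (transpose p q k)
    by-cases (yes refl) _          = subst (P p) (≡.sym transpose-l) Pp
    by-cases (no _)     (yes refl) = subst (P q) (≡.sym transpose-r) Pq
    by-cases (no k≢p)   (no k≢q)   = subst (P k) (≡.sym (transpose-fix k≢p k≢q)) (Pk k k≢p k≢q)

  transpose-involutive : ∀ k → transpose p q (transpose p q k) ≡ k
  transpose-involutive = transpose-elim (λ k k′ → transpose p q k′ ≡ k)
    transpose-r transpose-l (λ _ → transpose-fix)

-- Degrees and 2-switches

deg≡count : ∀ {n} (G : Graph n) i → deg G i ≡ count (E G i)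
deg≡count G i = sum-tabulate (⟦_⟧ ∘ E G i)

deg-cong : ∀ {n} {G H : Graph n} → G ≈E H → ∀ i → deg G i ≡ deg H i
deg-cong {G = G} {H} G≈H i rewrite deg≡count G i | deg≡count H i =
  sum-cong-≗ (λ j → cong ⟦_⟧ (G≈H i j))

-- Permuting the entries of a row keeps its sum. The two row indices may differ, as `mid-deg`
-- compares the rows of two exchanged vertices.
deg-transpose : ∀ {n} (G H : Graph n) p q i i′ →
  (∀ j → E H i′ j ≡ E G i (transpose p q j)) → deg G i ≡ deg H i′
deg-transpose G H p q i i′ eq = begin
  deg G i                        ≡⟨ deg≡count G i ⟩
  count (E G i)                  ≡⟨ sum-involution _ (transpose p q) (transpose-involutive p q) ⟩
  count (E G i ∘ transpose p q)  ≡⟨ sum-cong-≗ (λ j → cong ⟦_⟧ (eq j)) ⟨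
  count (E H i′)                 ≡⟨ deg≡count H i′ ⟨
  deg H i′ ∎
  where open ≡-Reasoning

SwitchAt : ∀ {n} → Graph n → Graph n → (a b c d : Fin n) → Set
SwitchAt G H a b c d =
    (a ≢ b × a ≢ c × a ≢ d × b ≢ c × b ≢ d × c ≢ d)
  × (E G a b ≡ true × E G c d ≡ true × E G a d ≡ false × E G b c ≡ false)
  × (∀ i j → SamePair i j a b → E H i j ≡ false)
  × (∀ i j → SamePair i j c d → E H i j ≡ false)
  × (∀ i j → SamePair i j a d → E H i j ≡ true)
  × (∀ i j → SamePair i j b c → E H i j ≡ true)
  × (∀ i j → ¬ SamePair i j a b → ¬ SamePair i j c d
           → ¬ SamePair i j a d → ¬ SamePair i j b c
           → E H i j ≡ E G i j)

SamePair-sym : ∀ {n} {i j x y : Fin n} → SamePair i j x y → SamePair i j y x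
SamePair-sym (inj₁ p) = inj₂ p
SamePair-sym (inj₂ p) = inj₁ p

edge-sym : ∀ {n} (G : Graph n) {i j b} → E G i j ≡ b → E G j i ≡ b
edge-sym G = trans (Graph.sym G _ _)

edge-≢ : ∀ {n} (G : Graph n) {i j} → E G i j ≡ true → i ≢ j
edge-≢ G {i} ij refl = true≢false ij (irrefl G i)

separated : ∀ {n} (G : Graph n) {i i′ j} → E G i j ≡ true → E G i′ j ≡ false → i ≢ i′
separated G ij i′j refl = true≢false ij i′j

module _ {n : ℕ} (G H : Graph n) where

  -- Together with `SwitchAt-rotate` this symmetry brings each of the four vertices of a switch to
  -- the first place, so the degree is computed in one row only.
  SwitchAt-reverse : ∀ {a b c d} → SwitchAt G H a b c d → SwitchAt G H b a d c
  SwitchAt-reverse ((a≢b , a≢c , a≢d , b≢c , b≢d , c≢d) , (ab , cd , ad , bc) , Hab , Hcd , Had , Hbc , H≡G) =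
    (≢-sym a≢b , b≢d , b≢c , a≢d , a≢c , ≢-sym c≢d) ,
    (edge-sym G ab , edge-sym G cd , bc , ad) ,
    (λ i j s → Hab i j (SamePair-sym s)) , (λ i j s → Hcd i j (SamePair-sym s)) , Hbc , Had ,
    λ i j ¬ab ¬cd ¬bc ¬ad → H≡G i j (¬ab ∘ SamePair-sym) (¬cd ∘ SamePair-sym) ¬ad ¬bc

  SwitchAt-rotate : ∀ {a b c d} → SwitchAt G H a b c d → SwitchAt G H c d a b
  SwitchAt-rotate ((a≢b , a≢c , a≢d , b≢c , b≢d , c≢d) , (ab , cd , ad , bc) , Hab , Hcd , Had , Hbc , H≡G) =
    (c≢d , ≢-sym a≢c , ≢-sym b≢c , ≢-sym a≢d , ≢-sym b≢d , a≢b) ,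
    (cd , ab , edge-sym G bc , edge-sym G ad) ,
    Hcd , Hab , (λ i j s → Hbc i j (SamePair-sym s)) , (λ i j s → Had i j (SamePair-sym s)) ,
    λ i j ¬cd ¬ab ¬bc ¬ad → H≡G i j ¬ab ¬cd (¬ad ∘ SamePair-sym) (¬bc ∘ SamePair-sym)

  -- Row `a` of `H` is row `a` of `G` with the entries at `b` and `d` exchanged.
  SwitchAt-row : ∀ {a b c d} → SwitchAt G H a b c d → deg G a ≡ deg H a
  SwitchAt-row {a} {b} {c} {d} ((a≢b , a≢c , a≢d , b≢c , b≢d , c≢d) , (ab , cd , ad , bc) , Hab , Hcd , Had , Hbc , H≡G) =
    deg-transpose G H b d a a (transpose-elim b d (λ j j′ → E H a j ≡ E G a j′)
      (trans (Hab a b (inj₁ (refl , refl))) (≡.sym ad))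
      (trans (Had a d (inj₁ (refl , refl))) (≡.sym ab))
      λ j j≢b j≢d → H≡G a j
        (λ { (inj₁ (_ , e)) → j≢b e ; (inj₂ (e , _)) → a≢b e })
        (λ { (inj₁ (e , _)) → a≢c e ; (inj₂ (e , _)) → a≢d e })
        (λ { (inj₁ (_ , e)) → j≢d e ; (inj₂ (e , _)) → a≢d e })
        (λ { (inj₁ (e , _)) → a≢b e ; (inj₂ (e , _)) → a≢c e }))

  TwoSwitch-deg : TwoSwitch G H → ∀ i → deg G i ≡ deg H i
  TwoSwitch-deg (a , b , c , d , s) i with i ≟ a | i ≟ b | i ≟ c | i ≟ d
  ... | yes refl | _ | _ | _ = SwitchAt-row s
  ... | no _ | yes refl | _ | _ = SwitchAt-row (SwitchAt-reverse s)
  ... | no _ | no _ | yes refl | _ = SwitchAt-row (SwitchAt-rotate s)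
  ... | no _ | no _ | no _ | yes refl = SwitchAt-row (SwitchAt-reverse (SwitchAt-rotate s))
  ... | no i≢a | no i≢b | no i≢c | no i≢d = ≡.sym row
    where
    H≡G = proj₂ (proj₂ (proj₂ (proj₂ (proj₂ (proj₂ s)))))
    row : deg H i ≡ deg G i
    row = trans (deg≡count H i) (trans (sum-cong-≗ λ j → cong ⟦_⟧ (H≡G i j
        (λ { (inj₁ (e , _)) → i≢a e ; (inj₂ (e , _)) → i≢b e })
        (λ { (inj₁ (e , _)) → i≢c e ; (inj₂ (e , _)) → i≢d e })
        (λ { (inj₁ (e , _)) → i≢a e ; (inj₂ (e , _)) → i≢d e })
        (λ { (inj₁ (e , _)) → i≢b e ; (inj₂ (e , _)) → i≢c e })))
      (≡.sym (deg≡count G i)))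

-- Hypercubes

module _ {m : ℕ} where

  -- The reason is parity: two single changes alter no coordinate or two, never exactly one.
  differ-triangle : ∀ {u v w : Vec Bool m} → DifferInOne u v → DifferInOne v w → DifferInOne u w → ⊥
  differ-triangle {u} {v} {w} (i , ui≢vi , uv) (j , vj≢wj , vw) (k , uk≢wk , uw) with i ≟ j
  ... | no i≢j = i≢j (trans (at-k i (ui≢vi ∘ λ e → trans e (≡.sym (vw i i≢j))))
                     (≡.sym (at-k j (vj≢wj ∘ trans (≡.sym (uv j (≢-sym i≢j)))))))
    where
    at-k : ∀ t → lookup u t ≢ lookup w t → t ≡ k
    at-k t ut≢wt with t ≟ k
    ... | yes t≡k = t≡k
    ... | no  t≢k = contradiction (uw t t≢k) ut≢wt
  ... | yes refl with k ≟ i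
  ...   | yes refl = uk≢wk (trans (Bool.¬-not ui≢vi) (≡.sym (Bool.¬-not (≢-sym vj≢wj))))
  ...   | no  k≢i  = uk≢wk (trans (uv k k≢i) (vw k k≢i))

  lookup-ext : ∀ {u v : Vec Bool m} → (∀ i → lookup u i ≡ lookup v i) → u ≡ v
  lookup-ext {u} {v} eq = trans (≡.sym (tabulate∘lookup u)) (trans (tabulate-cong eq) (tabulate∘lookup v))

  differ-same : ∀ {u v w : Vec Bool m} (p : DifferInOne u v) (q : DifferInOne u w) → proj₁ p ≡ proj₁ q → v ≡ w
  differ-same {u} {v} {w} (i , ui≢vi , uv) (i , ui≢wi , uw) refl = lookup-ext same
    where
    same : ∀ k → lookup v k ≡ lookup w k
    same k with k ≟ i
    ... | yes refl = trans (Bool.¬-not (≢-sym ui≢vi)) (≡.sym (Bool.¬-not (≢-sym ui≢wi)))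
    ... | no  k≢i  = trans (≡.sym (uv k k≢i)) (uw k k≢i)

  differ-sym : ∀ {u v : Vec Bool m} → DifferInOne u v → DifferInOne v u
  differ-sym (i , ui≢vi , uv) = i , ≢-sym ui≢vi , λ k k≢i → ≡.sym (uv k k≢i)

  -- The second change cannot be at the position of the first, since it would then lead back to `u`.
  differ-two : ∀ {u v w : Vec Bool m} (p : DifferInOne u v) (q : DifferInOne v w) → u ≢ w →
    lookup u (proj₁ p) ≢ lookup w (proj₁ p)
  differ-two {u} {v} p@(i , ui≢vi , uv) q@(j , vj≢wj , vw) u≢w ui≡wi with i ≟ j
  ... | yes i≡j = u≢w (differ-same {v} (differ-sym {u} {v} p) q i≡j)
  ... | no  i≢j = ui≢vi (trans ui≡wi (≡.sym (vw i i≢j)))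

  -- u and w differ exactly at the two positions in which u differs from a
  -- common neighbour and this neighbour from w.
  differ-K₂₃ : ∀ {u w x y z : Vec Bool m} →
    DifferInOne u x → DifferInOne u y → DifferInOne u z →
    DifferInOne x w → DifferInOne y w → DifferInOne z w →
    u ≢ w → x ≢ y → x ≢ z → y ≢ z → ⊥
  differ-K₂₃ {u} {w} ux@(_ , _ , ux≡) uy uz xw@(_ , _ , xw≡) yw zw u≢w x≢y x≢z y≢z =
    y≢z (differ-same {u} uy uz (trans (second uy yw x≢y) (≡.sym (second uz zw x≢z))))
    where
    second : ∀ {t} (ut : DifferInOne u t) → DifferInOne t w → _ ≢ t → proj₁ ut ≡ proj₁ xw
    second {t} ut tw x≢t with proj₁ ut ≟ proj₁ xw
    ... | yes e = e
    ... | no ¬e = contradiction (trans (ux≡ _ (λ e → x≢t (differ-same {u} ux ut (≡.sym e)))) (xw≡ _ ¬e))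
                    (differ-two {u} {t} ut tw u≢w)

-- Switching inside a partially prescribed subgraph

samePair? : ∀ {k} (p q x y : Fin k) → Dec (SamePair p q x y)
samePair? p q x y = (p ≟ x ×-dec q ≟ y) ⊎-dec (p ≟ y ×-dec q ≟ x)

SamePair-flip : ∀ {n} {i j x y : Fin n} → SamePair i j x y → SamePair j i x y
SamePair-flip (inj₁ (p , q)) = inj₂ (q , p)
SamePair-flip (inj₂ (p , q)) = inj₁ (q , p)

-- `nothing` marks a free pair. Comparing with `samePair?` makes the prescription symmetric.
value : ∀ {k l} → Vec (Fin k × Fin k) l → Vec Bool l → Fin k → Fin k → Maybe Bool
value []             []       p q = nothing
value ((x , y) ∷ ps) (b ∷ bs) p q with samePair? p q x y
... | yes _ = just b
... | no  _ = value ps bs p q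

value-sym : ∀ {k l} (ps : Vec (Fin k × Fin k) l) bs p q → value ps bs p q ≡ value ps bs q p
value-sym []             []       p q = refl
value-sym ((x , y) ∷ ps) (b ∷ bs) p q with samePair? p q x y | samePair? q p x y
... | yes _ | yes _ = refl
... | yes s | no ¬s = contradiction (SamePair-flip s) ¬s
... | no ¬s | yes s = contradiction (SamePair-flip s) ¬s
... | no _  | no _  = value-sym ps bs p q

Loopless : ∀ {k l} → Vec (Fin k × Fin k) l → Set
Loopless = All (λ (x , y) → x ≢ y)

loopless? : ∀ {k l} (ps : Vec (Fin k × Fin k) l) → Dec (Loopless ps)
loopless? = All.all? λ (x , y) → ¬? (x ≟ y)

value-diagonal : ∀ {k l} (ps : Vec (Fin k × Fin k) l) → Loopless ps → ∀ bs p → value ps bs p p ≡ nothing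
value-diagonal []             []           []       p = refl
value-diagonal ((x , y) ∷ ps) (x≢y ∷ x≢ys) (b ∷ bs) p with samePair? p p x y
... | yes (inj₁ (refl , e)) = contradiction e x≢y
... | yes (inj₂ (refl , e)) = contradiction (≡.sym e) x≢y
... | no  _                 = value-diagonal ps x≢ys bs p

-- A vector of Booleans prescribes the adjacency of the listed pairs of
-- vertices of Fin k; the remaining pairs are left free.
module Pattern {k l : ℕ} (pairs : Vec (Fin k × Fin k) l) where

  infix 8 _[_,_]
  _[_,_] : Vec Bool l → Fin k → Fin k → Maybe Bool
  _[_,_] = value pairs

  -- A counterpart of `SwitchAt` that is decided by evaluation. The last clause also covers free
  -- pairs, so one check on `Fin k` serves all their possible adjacencies.
  SwitchPattern : (g h : Vec Bool l) (a b c d : Fin k) → Set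
  SwitchPattern g h a b c d =
      (a ≢ b × a ≢ c × a ≢ d × b ≢ c × b ≢ d × c ≢ d)
    × (g [ a , b ] ≡ just true × g [ c , d ] ≡ just true × g [ a , d ] ≡ just false × g [ b , c ] ≡ just false)
    × (h [ a , b ] ≡ just false × h [ c , d ] ≡ just false × h [ a , d ] ≡ just true × h [ b , c ] ≡ just true)
    × (∀ p q → SamePair p q a b ⊎ SamePair p q c d ⊎ SamePair p q a d ⊎ SamePair p q b c ⊎ h [ p , q ] ≡ g [ p , q ])

  private
    infix 4 _≟ᵐ_
    _≟ᵐ_ : (x y : Maybe Bool) → Dec (x ≡ y)
    _≟ᵐ_ = Maybe.≡-dec Bool._≟_

  switchPattern? : ∀ g h a b c d → Dec (SwitchPattern g h a b c d)
  switchPattern? g h a b c d =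
    (¬? (a ≟ b) ×-dec ¬? (a ≟ c) ×-dec ¬? (a ≟ d) ×-dec ¬? (b ≟ c) ×-dec ¬? (b ≟ d) ×-dec ¬? (c ≟ d))
    ×-dec (g [ a , b ] ≟ᵐ just true ×-dec g [ c , d ] ≟ᵐ just true ×-dec g [ a , d ] ≟ᵐ just false ×-dec g [ b , c ] ≟ᵐ just false)
    ×-dec (h [ a , b ] ≟ᵐ just false ×-dec h [ c , d ] ≟ᵐ just false ×-dec h [ a , d ] ≟ᵐ just true ×-dec h [ b , c ] ≟ᵐ just true)
    ×-dec all? λ p → all? λ q → samePair? p q a b ⊎-dec samePair? p q c d ⊎-dec samePair? p q a d
            ⊎-dec samePair? p q b c ⊎-dec h [ p , q ] ≟ᵐ g [ p , q ]

  Switchable : (g h : Vec Bool l) → Set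
  Switchable g h = ∃[ a ] ∃[ b ] ∃[ c ] ∃[ d ] SwitchPattern g h a b c d

  switchable : ∀ {g h} a b c d {_ : True (switchPattern? g h a b c d)} → Switchable g h
  switchable a b c d {t} = a , b , c , d , toWitness t

  Conflict : (g h : Vec Bool l) → Set
  Conflict g h = ∃[ p ] ∃[ q ] (g [ p , q ] ≡ just true × h [ p , q ] ≡ just false)

  conflict : ∀ {g h} p q {_ : True (g [ p , q ] ≟ᵐ just true ×-dec h [ p , q ] ≟ᵐ just false)} → Conflict g h
  conflict p q {t} = p , q , toWitness t

  module Patch (loopless : Loopless pairs) {n : ℕ} (G : Graph n) (vs : Vec (Fin n) k) (unique : Unique vs) where

    ι : Fin k → Fin n
    ι = lookup vs

    ι-injective : ∀ {p q} → ι p ≡ ι q → p ≡ q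
    ι-injective = lookup-injective unique _ _

    position : ∀ i → Dec (∃[ p ] ι p ≡ i)
    position i = any? (λ p → ι p ≟ i)

    override : Vec Bool l → ∀ {i j} → Dec (∃[ p ] ι p ≡ i) → Dec (∃[ p ] ι p ≡ j) → Bool
    override bs {i} {j} (yes (p , _)) (yes (q , _)) = fromMaybe (E G i j) (bs [ p , q ])
    override bs {i} {j} (yes _)       (no _)        = E G i j
    override bs {i} {j} (no _)        _             = E G i j

    -- Free pairs, and pairs not inside the image of `vs`, keep their adjacency in `G`; two patched
    -- graphs can differ only at listed pairs.
    patch : Vec Bool l → Graph n
    E (patch bs) i j = override bs (position i) (position j)
    Graph.sym (patch bs) i j with position i | position j
    ... | yes (p , _) | yes (q , _) = cong₂ fromMaybe (Graph.sym G i j) (value-sym pairs bs p q)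
    ... | yes _       | no _        = Graph.sym G i j
    ... | no _        | yes _       = Graph.sym G i j
    ... | no _        | no _        = Graph.sym G i j
    irrefl (patch bs) i with position i
    ... | yes (p , _) rewrite value-diagonal pairs loopless bs p = irrefl G i
    ... | no _        = irrefl G i

    patch-value : ∀ bs p q {b} → bs [ p , q ] ≡ just b → E (patch bs) (ι p) (ι q) ≡ b
    patch-value bs p q eq with position (ι p) | position (ι q)
    ... | no ¬p | _ = contradiction (p , refl) ¬p
    ... | yes _ | no ¬q = contradiction (q , refl) ¬q
    ... | yes (p′ , p′≡p) | yes (q′ , q′≡q)
      rewrite ι-injective p′≡p | ι-injective q′≡q | eq = refl

    patch-value-sym : ∀ bs p q {b i j} → SamePair i j (ι p) (ι q) → bs [ p , q ] ≡ just b → E (patch bs) i j ≡ b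
    patch-value-sym bs p q (inj₁ (refl , refl)) eq = patch-value bs p q eq
    patch-value-sym bs p q (inj₂ (refl , refl)) eq = patch-value bs q p (trans (value-sym pairs bs q p) eq)

    patch-switch : ∀ {g h} → Switchable g h → TwoSwitch (patch g) (patch h)
    patch-switch {g} {h} (a , b , c , d ,
      (a≢b , a≢c , a≢d , b≢c , b≢d , c≢d) , (gab , gcd , gad , gbc) , (hab , hcd , had , hbc) , rest) =
      ι a , ι b , ι c , ι d ,
      (a≢b ∘ ι-injective , a≢c ∘ ι-injective , a≢d ∘ ι-injective ,
       b≢c ∘ ι-injective , b≢d ∘ ι-injective , c≢d ∘ ι-injective) ,
      (patch-value g a b gab , patch-value g c d gcd , patch-value g a d gad , patch-value g b c gbc) ,
      (λ i j s → patch-value-sym h a b s hab) , (λ i j s → patch-value-sym h c d s hcd) ,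
      (λ i j s → patch-value-sym h a d s had) , (λ i j s → patch-value-sym h b c s hbc) , unchanged
      where
      lift : ∀ {p q x y} → SamePair p q x y → SamePair (ι p) (ι q) (ι x) (ι y)
      lift (inj₁ (refl , refl)) = inj₁ (refl , refl)
      lift (inj₂ (refl , refl)) = inj₂ (refl , refl)
      unchanged : ∀ i j → ¬ SamePair i j (ι a) (ι b) → ¬ SamePair i j (ι c) (ι d) →
        ¬ SamePair i j (ι a) (ι d) → ¬ SamePair i j (ι b) (ι c) → E (patch h) i j ≡ E (patch g) i j
      unchanged i j ¬ab ¬cd ¬ad ¬bc with position i | position j
      ... | no _  | _    = refl
      ... | yes _ | no _ = refl
      ... | yes (p , refl) | yes (q , refl) with rest p q
      ... | inj₁ s = contradiction (lift s) ¬ab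
      ... | inj₂ (inj₁ s) = contradiction (lift s) ¬cd
      ... | inj₂ (inj₂ (inj₁ s)) = contradiction (lift s) ¬ad
      ... | inj₂ (inj₂ (inj₂ (inj₁ s))) = contradiction (lift s) ¬bc
      ... | inj₂ (inj₂ (inj₂ (inj₂ eq))) = cong (fromMaybe _) eq

    patch-conflict : ∀ {g h} → Conflict g h → ¬ (patch g ≈E patch h)
    patch-conflict {g} {h} (p , q , gpq , hpq) g≈h =
      true≢false (patch-value g p q gpq) (trans (g≈h (ι p) (ι q)) (patch-value h p q hpq))

    Matches : Vec Bool l → Set
    Matches = Pointwise (λ (x , y) b → E G (ι x) (ι y) ≡ b) pairs

    patch-matching : ∀ {g} → Matches g → patch g ≈E G
    patch-matching {g} match i j with position i | position j
    ... | no _  | _    = refl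
    ... | yes _ | no _ = refl
    ... | yes (p , refl) | yes (q , refl) = agree match p q
      where
      agree : ∀ {l′} {ps : Vec (Fin k × Fin k) l′} {bs} → Pointwise (λ (x , y) b → E G (ι x) (ι y) ≡ b) ps bs →
        ∀ p q → fromMaybe (E G (ι p) (ι q)) (value ps bs p q) ≡ E G (ι p) (ι q)
      agree [] p q = refl
      agree {ps = (x , y) ∷ _} (e ∷ es) p q with samePair? p q x y
      ... | yes (inj₁ (refl , refl)) = ≡.sym e
      ... | yes (inj₂ (refl , refl)) = ≡.sym (edge-sym G e)
      ... | no _ = agree es p q

pattern I = true
pattern O = false

-- Configurations excluded by a hypercube of realizations

module Hypercube {n : ℕ} {d : Vec ℕ n} (cube : IsHypercube (Realization d) _≈R_ AdjR) where

  φ = proj₁ (proj₂ cube)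

  φ-injective : ∀ x y → φ x ≡ φ y → x ≈R y
  φ-injective = proj₁ (proj₂ (proj₂ (proj₂ cube)))

  switch-differ : ∀ {x y} → TwoSwitch (graph x) (graph y) → DifferInOne (φ x) (φ y)
  switch-differ {x} {y} s = Equivalence.to (proj₂ (proj₂ (proj₂ (proj₂ (proj₂ cube)))) x y) (inj₁ s)

  φ-≢ : ∀ {x y} → ¬ (x ≈R y) → φ x ≢ φ y
  φ-≢ x≉y e = x≉y (φ-injective _ _ e)

  module Excluded {k l : ℕ} (pairs : Vec (Fin k × Fin k) l) (loopless : Loopless pairs)
    (R : Realization d) (vs : Vec (Fin n) k) (unique : Unique vs) where

    open Pattern pairs
    open Patch loopless (graph R) vs unique

    Realizes : Vec Bool l → Set
    Realizes g = ∀ i → deg (patch g) i ≡ lookup d i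

    -- The configurations consist of patched graphs throughout, even where the patch is pointwise
    -- equal to `graph R`, so only the degrees have to be transferred.
    realizes-match : ∀ {g} → Matches g → Realizes g
    realizes-match match i = trans (deg-cong {G = patch _} {H = graph R} (patch-matching match) i) (degree R i)

    realizes-switch : ∀ {g h} → Switchable g h → Realizes g → Realizes h
    realizes-switch s rg i = trans (≡.sym (TwoSwitch-deg (patch _) (patch _) (patch-switch s) i)) (rg i)

    realization : ∀ g → Realizes g → Realization d
    graph  (realization g rg) = patch g
    degree (realization g rg) = rg

    differ : ∀ {g h} {rg : Realizes g} {rh : Realizes h} → Switchable g h →
      DifferInOne (φ (realization g rg)) (φ (realization h rh))
    differ s = switch-differ (patch-switch s)

    no-triangle : ∀ {g h w} →
      Switchable g h → Switchable g w → Switchable h w →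
      ¬ Matches g
    no-triangle {g} {h} {w} gh gw hw match =
      differ-triangle {u = φ (realization g rg)} {φ (realization h (realizes-switch gh rg))} {φ (realization w (realizes-switch gw rg))}
        (differ gh) (differ hw) (differ gw)
      where
      rg = realizes-match match

    no-K₂₃ : ∀ {g h x y z} →
      Switchable g x → Switchable g y → Switchable g z →
      Switchable x h → Switchable y h → Switchable z h →
      Conflict g h → Conflict x y → Conflict x z → Conflict y z →
      ¬ Matches g
    no-K₂₃ {g} {h} {x} {y} {z} gx gy gz xh yh zh g≢h x≢y x≢z y≢z match =
      differ-K₂₃ {u = φ (realization g rg)} {φ (realization h (realizes-switch xh rx))}
        {φ (realization x rx)} {φ (realization y ry)} {φ (realization z rz)}
        (differ gx) (differ gy) (differ gz) (differ xh) (differ yh) (differ zh)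
        (φ-≢ (patch-conflict g≢h)) (φ-≢ (patch-conflict x≢y)) (φ-≢ (patch-conflict x≢z)) (φ-≢ (patch-conflict y≢z))
      where
      rg = realizes-match match
      rx = realizes-switch gx rg
      ry = realizes-switch gy rg
      rz = realizes-switch gz rg

  module _ (R : Realization d) where

    private
      G = graph R
      s : ∀ {i j b} → E G i j ≡ b → E G j i ≡ b
      s = edge-sym G
      separate = separated G

    -- The three perfect matchings on four vertices are pairwise one switch apart.
    no-2K₂ : ∀ {a b c d} → E G a b ≡ true → E G c d ≡ true →
      E G a c ≡ false → E G b d ≡ false → E G a d ≡ false → E G b c ≡ false → ⊥
    no-2K₂ {a} {b} {c} {d} ab cd ac bd ad bc =
      no-triangle {I ∷ I ∷ O ∷ O ∷ O ∷ O ∷ []} {O ∷ O ∷ O ∷ O ∷ I ∷ I ∷ []} {O ∷ O ∷ I ∷ I ∷ O ∷ O ∷ []}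
        (switchable 0F 1F 2F 3F) (switchable 0F 1F 3F 2F) (switchable 0F 3F 1F 2F)
        (ab ∷ cd ∷ ac ∷ bd ∷ ad ∷ bc ∷ [])
      where
      pairs : Vec (Fin 4 × Fin 4) 6
      pairs = (0F , 1F) ∷ (2F , 3F) ∷ (0F , 2F) ∷ (1F , 3F) ∷ (0F , 3F) ∷ (1F , 2F) ∷ []
      open Pattern pairs using (switchable; conflict)
      open Excluded pairs (from-yes (loopless? pairs)) R (a ∷ b ∷ c ∷ d ∷ [])
        ( (edge-≢ G ab ∷ separate ab (s bc) ∷ separate ab (s bd) ∷ [])
        ∷ (separate (s ab) (s ac) ∷ separate (s ab) (s ad) ∷ [])
        ∷ (edge-≢ G cd ∷ [])
        ∷ [] ∷ [])

    -- The complements of the three perfect matchings: the 4-cycles on the given vertices.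
    no-C₄ : ∀ {a b c d} → a ≢ c → b ≢ d → E G a b ≡ true → E G b c ≡ true → E G c d ≡ true → E G d a ≡ true →
      E G a c ≡ false → E G b d ≡ false → ⊥
    no-C₄ {a} {b} {c} {d} a≢c b≢d ab bc cd da ac bd =
      no-triangle {I ∷ I ∷ O ∷ O ∷ I ∷ I ∷ []} {O ∷ O ∷ I ∷ I ∷ I ∷ I ∷ []} {I ∷ I ∷ I ∷ I ∷ O ∷ O ∷ []}
        (switchable 0F 1F 3F 2F) (switchable 0F 3F 1F 2F) (switchable 0F 3F 2F 1F)
        (ab ∷ cd ∷ ac ∷ bd ∷ s da ∷ bc ∷ [])
      where
      pairs : Vec (Fin 4 × Fin 4) 6
      pairs = (0F , 1F) ∷ (2F , 3F) ∷ (0F , 2F) ∷ (1F , 3F) ∷ (0F , 3F) ∷ (1F , 2F) ∷ []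
      open Pattern pairs using (switchable; conflict)
      open Excluded pairs (from-yes (loopless? pairs)) R (a ∷ b ∷ c ∷ d ∷ [])
        ( (edge-≢ G ab ∷ a≢c ∷ edge-≢ G (s da) ∷ [])
        ∷ (edge-≢ G bc ∷ b≢d ∷ [])
        ∷ (edge-≢ G cd ∷ [])
        ∷ [] ∷ [])

    -- One of `a`, `v`, `c` is joined to `d` and the other two to `b`; the three choices of this one
    -- are pairwise one switch apart. The adjacencies among `a`, `v`, `c` and between `b` and `d`
    -- are left free.
    no-unbalanced : ∀ {a v c b d} → a ≢ v → a ≢ d → v ≢ d → c ≢ b →
      E G a b ≡ true → E G a d ≡ false → E G v b ≡ true → E G v d ≡ false → E G c b ≡ false → E G c d ≡ true → ⊥
    no-unbalanced {a} {v} {c} {b} {d} a≢v a≢d v≢d c≢b ab ad vb vd cb cd =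
      no-triangle {I ∷ O ∷ I ∷ O ∷ O ∷ I ∷ []} {O ∷ I ∷ I ∷ O ∷ I ∷ O ∷ []} {I ∷ O ∷ O ∷ I ∷ I ∷ O ∷ []}
        (switchable 0F 3F 2F 4F) (switchable 1F 3F 2F 4F) (switchable 0F 4F 1F 3F)
        (ab ∷ ad ∷ vb ∷ vd ∷ cb ∷ cd ∷ [])
      where
      pairs : Vec (Fin 5 × Fin 5) 6
      pairs = (0F , 3F) ∷ (0F , 4F) ∷ (1F , 3F) ∷ (1F , 4F) ∷ (2F , 3F) ∷ (2F , 4F) ∷ []
      open Pattern pairs using (switchable; conflict)
      open Excluded pairs (from-yes (loopless? pairs)) R (a ∷ v ∷ c ∷ b ∷ d ∷ [])
        ( (a≢v ∷ separate ab cb ∷ edge-≢ G ab ∷ a≢d ∷ [])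
        ∷ (separate vb cb ∷ edge-≢ G vb ∷ v≢d ∷ [])
        ∷ (c≢b ∷ edge-≢ G cd ∷ [])
        ∷ (separate (s ab) (s ad) ∷ [])
        ∷ [] ∷ [])

    -- The five graphs are 5-cycles on the same vertices. The given cycle and the one with edges
    -- `cd`, `ea`, `ac`, `bd`, `be` have the other three as common neighbours.
    no-C₅ : ∀ {a b c d e} → E G a b ≡ true → E G b c ≡ true → E G c d ≡ true → E G d e ≡ true → E G e a ≡ true →
      E G a c ≡ false → E G a d ≡ false → E G b d ≡ false → E G b e ≡ false → E G c e ≡ false → ⊥
    no-C₅ {a} {b} {c} {d} {e} ab bc cd de ea ac ad bd be ce =
      no-K₂₃ {I ∷ I ∷ I ∷ I ∷ I ∷ O ∷ O ∷ O ∷ O ∷ O ∷ []} {O ∷ O ∷ I ∷ O ∷ I ∷ I ∷ O ∷ I ∷ I ∷ O ∷ []}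
        {O ∷ I ∷ O ∷ I ∷ I ∷ I ∷ O ∷ I ∷ O ∷ O ∷ []} {O ∷ I ∷ I ∷ O ∷ I ∷ O ∷ I ∷ O ∷ I ∷ O ∷ []} {I ∷ O ∷ I ∷ O ∷ I ∷ O ∷ O ∷ I ∷ O ∷ I ∷ []}
        (switchable 0F 1F 3F 2F) (switchable 0F 1F 4F 3F) (switchable 1F 2F 4F 3F)
        (switchable 1F 2F 3F 4F) (switchable 0F 3F 1F 2F) (switchable 0F 1F 4F 2F)
        (conflict 0F 1F) (conflict 3F 4F) (conflict 1F 2F) (conflict 1F 2F)
        (ab ∷ bc ∷ cd ∷ de ∷ ea ∷ ac ∷ ad ∷ bd ∷ be ∷ ce ∷ [])
      where
      pairs : Vec (Fin 5 × Fin 5) 10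
      pairs = (0F , 1F) ∷ (1F , 2F) ∷ (2F , 3F) ∷ (3F , 4F) ∷ (4F , 0F) ∷ (0F , 2F) ∷ (0F , 3F) ∷ (1F , 3F) ∷ (1F , 4F) ∷ (2F , 4F) ∷ []
      open Pattern pairs using (switchable; conflict)
      open Excluded pairs (from-yes (loopless? pairs)) R (a ∷ b ∷ c ∷ d ∷ e ∷ [])
        ( (edge-≢ G ab ∷ separate (s ea) ce ∷ separate ab (s bd) ∷ edge-≢ G (s ea) ∷ [])
        ∷ (edge-≢ G bc ∷ separate (s ab) (s ad) ∷ separate bc (s ce) ∷ [])
        ∷ (edge-≢ G cd ∷ separate (s bc) (s be) ∷ [])
        ∷ (edge-≢ G de ∷ [])
        ∷ [] ∷ [])

    -- Perfect matchings between the two triples are permutations of three elements. The identity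
    -- and a 3-cycle have the three transpositions as common neighbours. Pairs within a triple are
    -- left free.
    no-3K₂ : ∀ (K : Fin n → Bool) {x₀ x₁ x₂ y₀ y₁ y₂} →
      K x₀ ≡ false → K x₁ ≡ false → K x₂ ≡ false → K y₀ ≡ true → K y₁ ≡ true → K y₂ ≡ true →
      E G x₀ y₀ ≡ true → E G x₀ y₁ ≡ false → E G x₀ y₂ ≡ false →
      E G x₁ y₀ ≡ false → E G x₁ y₁ ≡ true → E G x₁ y₂ ≡ false →
      E G x₂ y₀ ≡ false → E G x₂ y₁ ≡ false → E G x₂ y₂ ≡ true → ⊥
    no-3K₂ K {x₀} {x₁} {x₂} {y₀} {y₁} {y₂} Kx₀ Kx₁ Kx₂ Ky₀ Ky₁ Ky₂ e₀₀ e₀₁ e₀₂ e₁₀ e₁₁ e₁₂ e₂₀ e₂₁ e₂₂ =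
      no-K₂₃ {I ∷ O ∷ O ∷ O ∷ I ∷ O ∷ O ∷ O ∷ I ∷ []} {O ∷ O ∷ I ∷ I ∷ O ∷ O ∷ O ∷ I ∷ O ∷ []}
        {O ∷ O ∷ I ∷ O ∷ I ∷ O ∷ I ∷ O ∷ O ∷ []} {O ∷ I ∷ O ∷ I ∷ O ∷ O ∷ O ∷ O ∷ I ∷ []} {I ∷ O ∷ O ∷ O ∷ O ∷ I ∷ O ∷ I ∷ O ∷ []}
        (switchable 0F 3F 2F 5F) (switchable 0F 3F 1F 4F) (switchable 1F 4F 2F 5F)
        (switchable 1F 4F 2F 3F) (switchable 0F 4F 2F 5F) (switchable 0F 3F 1F 5F)
        (conflict 0F 3F) (conflict 0F 5F) (conflict 0F 5F) (conflict 0F 4F)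
        (e₀₀ ∷ e₀₁ ∷ e₀₂ ∷ e₁₀ ∷ e₁₁ ∷ e₁₂ ∷ e₂₀ ∷ e₂₁ ∷ e₂₂ ∷ [])
      where
      x≢y : ∀ {x y} → K x ≡ false → K y ≡ true → x ≢ y
      x≢y Kx Ky refl = true≢false Ky Kx
      pairs : Vec (Fin 6 × Fin 6) 9
      pairs = (0F , 3F) ∷ (0F , 4F) ∷ (0F , 5F) ∷ (1F , 3F) ∷ (1F , 4F) ∷ (1F , 5F) ∷ (2F , 3F) ∷ (2F , 4F) ∷ (2F , 5F) ∷ []
      open Pattern pairs using (switchable; conflict)
      open Excluded pairs (from-yes (loopless? pairs)) R (x₀ ∷ x₁ ∷ x₂ ∷ y₀ ∷ y₁ ∷ y₂ ∷ [])
        ( (separate e₀₀ e₁₀ ∷ separate e₀₀ e₂₀ ∷ x≢y Kx₀ Ky₀ ∷ x≢y Kx₀ Ky₁ ∷ x≢y Kx₀ Ky₂ ∷ [])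
        ∷ (separate e₁₁ e₂₁ ∷ x≢y Kx₁ Ky₀ ∷ x≢y Kx₁ Ky₁ ∷ x≢y Kx₁ Ky₂ ∷ [])
        ∷ (x≢y Kx₂ Ky₀ ∷ x≢y Kx₂ Ky₁ ∷ x≢y Kx₂ Ky₂ ∷ [])
        ∷ (separate (s e₀₀) (s e₀₁) ∷ separate (s e₀₀) (s e₀₂) ∷ [])
        ∷ (separate (s e₁₁) (s e₁₂) ∷ [])
        ∷ [] ∷ [])

    -- The pattern of `no-3K₂` with edges and non-edges between the triples exchanged: the
    -- permutation now gives the missing edges.
    no-C₆ : ∀ (K : Fin n → Bool) {x₀ x₁ x₂ y₀ y₁ y₂} →
      K x₀ ≡ false → K x₁ ≡ false → K x₂ ≡ false → K y₀ ≡ true → K y₁ ≡ true → K y₂ ≡ true →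
      E G x₀ y₀ ≡ false → E G x₀ y₁ ≡ true → E G x₀ y₂ ≡ true →
      E G x₁ y₀ ≡ true → E G x₁ y₁ ≡ false → E G x₁ y₂ ≡ true →
      E G x₂ y₀ ≡ true → E G x₂ y₁ ≡ true → E G x₂ y₂ ≡ false → ⊥
    no-C₆ K {x₀} {x₁} {x₂} {y₀} {y₁} {y₂} Kx₀ Kx₁ Kx₂ Ky₀ Ky₁ Ky₂ e₀₀ e₀₁ e₀₂ e₁₀ e₁₁ e₁₂ e₂₀ e₂₁ e₂₂ =
      no-K₂₃ {O ∷ I ∷ I ∷ I ∷ O ∷ I ∷ I ∷ I ∷ O ∷ []} {I ∷ O ∷ I ∷ I ∷ I ∷ O ∷ O ∷ I ∷ I ∷ []}
        {O ∷ I ∷ I ∷ I ∷ I ∷ O ∷ I ∷ O ∷ I ∷ []} {I ∷ O ∷ I ∷ O ∷ I ∷ I ∷ I ∷ I ∷ O ∷ []} {I ∷ I ∷ O ∷ I ∷ O ∷ I ∷ O ∷ I ∷ I ∷ []}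
        (switchable 1F 5F 2F 4F) (switchable 0F 4F 1F 3F) (switchable 0F 5F 2F 3F)
        (switchable 0F 4F 2F 3F) (switchable 1F 5F 2F 3F) (switchable 0F 4F 1F 5F)
        (conflict 0F 4F) (conflict 0F 4F) (conflict 0F 5F) (conflict 0F 5F)
        (e₀₀ ∷ e₀₁ ∷ e₀₂ ∷ e₁₀ ∷ e₁₁ ∷ e₁₂ ∷ e₂₀ ∷ e₂₁ ∷ e₂₂ ∷ [])
      where
      x≢y : ∀ {x y} → K x ≡ false → K y ≡ true → x ≢ y
      x≢y Kx Ky refl = true≢false Ky Kx
      pairs : Vec (Fin 6 × Fin 6) 9
      pairs = (0F , 3F) ∷ (0F , 4F) ∷ (0F , 5F) ∷ (1F , 3F) ∷ (1F , 4F) ∷ (1F , 5F) ∷ (2F , 3F) ∷ (2F , 4F) ∷ (2F , 5F) ∷ []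
      open Pattern pairs using (switchable; conflict)
      open Excluded pairs (from-yes (loopless? pairs)) R (x₀ ∷ x₁ ∷ x₂ ∷ y₀ ∷ y₁ ∷ y₂ ∷ [])
        ( (separate e₀₁ e₁₁ ∷ separate e₀₂ e₂₂ ∷ x≢y Kx₀ Ky₀ ∷ x≢y Kx₀ Ky₁ ∷ x≢y Kx₀ Ky₂ ∷ [])
        ∷ (separate e₁₂ e₂₂ ∷ x≢y Kx₁ Ky₀ ∷ x≢y Kx₁ Ky₁ ∷ x≢y Kx₁ Ky₂ ∷ [])
        ∷ (x≢y Kx₂ Ky₀ ∷ x≢y Kx₂ Ky₁ ∷ x≢y Kx₂ Ky₂ ∷ [])
        ∷ (separate (s e₁₀) (s e₁₁) ∷ separate (s e₂₀) (s e₂₂) ∷ [])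
        ∷ (separate (s e₂₁) (s e₂₂) ∷ [])
        ∷ [] ∷ [])

-- The Földes–Hammer theorem

set : ∀ {n} → (Fin n → Bool) → Fin n → Bool → Fin n → Bool
set K x b i with i ≟ x
... | yes _ = b
... | no  _ = K i

set-at : ∀ {n} (K : Fin n → Bool) x b → set K x b x ≡ b
set-at K x b with x ≟ x
... | yes _  = refl
... | no x≢x = contradiction refl x≢x

set-other : ∀ {n} (K : Fin n → Bool) x b {i} → i ≢ x → set K x b i ≡ K i
set-other K x b {i} i≢x with i ≟ x
... | yes i≡x = contradiction i≡x i≢x
... | no  _   = refl

set-false : ∀ {n} (K : Fin n → Bool) x {i} → set K x false i ≡ true → i ≢ x × K i ≡ true
set-false K x {i} Ki with i ≟ x
... | yes _  = contradiction Ki λ ()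
... | no i≢x = i≢x , Ki

module FöldesHammer {n : ℕ} (G : Graph n)
  (no-2K₂ : ∀ {a b c d} → E G a b ≡ true → E G c d ≡ true →
      E G a c ≡ false → E G b d ≡ false → E G a d ≡ false → E G b c ≡ false → ⊥)
  (no-C₄ : ∀ {a b c d} → a ≢ c → b ≢ d → E G a b ≡ true → E G b c ≡ true → E G c d ≡ true → E G d a ≡ true →
      E G a c ≡ false → E G b d ≡ false → ⊥)
  (no-C₅ : ∀ {a b c d e} → E G a b ≡ true → E G b c ≡ true → E G c d ≡ true → E G d e ≡ true → E G e a ≡ true →
      E G a c ≡ false → E G a d ≡ false → E G b d ≡ false → E G b e ≡ false → E G c e ≡ false → ⊥)
  where

  private
    s : ∀ {i j b} → E G i j ≡ b → E G j i ≡ b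
    s = edge-sym G

  Clique : (Fin n → Bool) → Set
  Clique K = ∀ i j → i ≢ j → K i ≡ true → K j ≡ true → E G i j ≡ true

  -- The weights make a larger clique heavier, and among cliques of the same
  -- size the one with the larger degree sum.
  weight : Fin n → ℕ
  weight i = suc n + deg G i

  contribution : (Fin n → Bool) → Fin n → ℕ
  contribution K i = if K i then weight i else 0

  total : (Fin n → Bool) → ℕ
  total K = sum (contribution K)

  total-≤ : ∀ K → total K ≤ sum weight
  total-≤ K = sum-mono-≤ _ _ bound
    where
    bound : ∀ i → contribution K i ≤ weight i
    bound i with K i
    ... | true  = ≤-refl
    ... | false = z≤n

  contribution-set : ∀ K x b → ∀ j → j ≢ x → contribution (set K x b) j ≡ contribution K j
  contribution-set K x b j j≢x = cong (if_then weight j else 0) (set-other K x b j≢x)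

  total-insert : ∀ K x → K x ≡ false → total (set K x true) ≡ total K + weight x
  total-insert K x Kx with sum-update (contribution (set K x true)) (contribution K) x (contribution-set K x true)
  ... | eq rewrite set-at K x true | Kx = trans (≡.sym (+-identityʳ _)) eq

  total-delete : ∀ K x → K x ≡ true → total (set K x false) + weight x ≡ total K
  total-delete K x Kx with sum-update (contribution (set K x false)) (contribution K) x (contribution-set K x false)
  ... | eq rewrite set-at K x false | Kx = trans eq (+-identityʳ _)

  clique-insert : ∀ {K x} → Clique K → (∀ u → u ≢ x → K u ≡ true → E G x u ≡ true) → Clique (set K x true)
  clique-insert {K} {x} clique complete i j i≢j Ki Kj with i ≟ x | j ≟ x
  ... | yes refl | yes refl = contradiction refl i≢j
  ... | yes refl | no j≢x   = complete j j≢x Kj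
  ... | no i≢x   | yes refl = s (complete i i≢x Ki)
  ... | no _     | no _     = clique i j i≢j Ki Kj

  clique-delete : ∀ {K x} → Clique K → Clique (set K x false)
  clique-delete {K} {x} clique i j i≢j Ki Kj = clique i j i≢j (proj₂ (set-false K x Ki)) (proj₂ (set-false K x Kj))

  Heavier : (Fin n → Bool) → Set
  Heavier K = ∃[ K′ ] (Clique K′ × total K < total K′)

  heavier-insert : ∀ {K x} → Clique K → K x ≡ false → (∀ u → K u ≡ true → E G x u ≡ true) → Heavier K
  heavier-insert {K} {x} clique Kx complete = set K x true , clique-insert clique (λ u _ → complete u) ,
    subst (total K <_) (≡.sym (total-insert K x Kx)) (m<m+n (total K) (s≤s z≤n))

  module _ {K : Fin n → Bool} (clique : Clique K) where

    K-≢ : ∀ {i j} → K i ≡ false → K j ≡ true → i ≢ j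
    K-≢ Ki Kj refl = true≢false Kj Ki

    swap-total : ∀ {z x} → K z ≡ true → K x ≡ false →
      total (set (set K z false) x true) + weight z ≡ total K + weight x
    swap-total {z} {x} Kz Kx = begin
      total (set K′ x true) + weight z    ≡⟨ cong (_+ weight z) (total-insert K′ x K′x) ⟩
      total K′ + weight x + weight z      ≡⟨ +-assoc (total K′) _ _ ⟩
      total K′ + (weight x + weight z)    ≡⟨ cong (total K′ +_) (+-comm (weight x) (weight z)) ⟩
      total K′ + (weight z + weight x)    ≡⟨ +-assoc (total K′) _ _ ⟨
      total K′ + weight z + weight x      ≡⟨ cong (_+ weight x) (total-delete K z Kz) ⟩
      total K + weight x                  ∎
      where
      open ≡-Reasoning
      K′ = set K z false
      K′x = trans (set-other K z false (K-≢ Kx Kz)) Kx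

    swap-clique : ∀ {z x} → (∀ u → u ≢ z → K u ≡ true → E G x u ≡ true) → Clique (set (set K z false) x true)
    swap-clique {z} complete = clique-insert (clique-delete clique) λ u _ K′u →
      complete u (proj₁ (set-false K z K′u)) (proj₂ (set-false K z K′u))

    heavier-two : ∀ {x y z} → K x ≡ false → K y ≡ false → K z ≡ true → E G x y ≡ true →
      (∀ u → u ≢ z → K u ≡ true → E G x u ≡ true) → (∀ u → u ≢ z → K u ≡ true → E G y u ≡ true) → Heavier K
    heavier-two {x} {y} {z} Kx Ky Kz xy cx cy =
      set K″ y true , clique-insert (swap-clique cx) complete , heavier
      where
      K″ = set (set K z false) x true
      y≢x = ≢-sym (edge-≢ G xy)
      K″y : K″ y ≡ false
      K″y = trans (set-other _ x true y≢x) (trans (set-other K z false (K-≢ Ky Kz)) Ky)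
      complete : ∀ u → u ≢ y → K″ u ≡ true → E G y u ≡ true
      complete u u≢y K″u with u ≟ x
      ... | yes refl = s xy
      ... | no  _    = cy u (proj₁ (set-false K z K″u)) (proj₂ (set-false K z K″u))
      -- As `deg G z` is at most `n`, one weight is at most `2n + 1` while two are at least
      -- `2n + 2`. This explains the summand `suc n` in `weight`.
      z<xy : weight z < weight x + weight y
      z<xy = s≤s (begin
        weight z            ≤⟨ +-monoʳ-≤ (suc n) (≤-trans (≤-reflexive (deg≡count G z)) (count-≤ (E G z))) ⟩
        suc n + n           ≡⟨ +-suc n n ⟨
        n + suc n           ≤⟨ +-mono-≤ (m≤m+n n (deg G x)) (m≤m+n (suc n) (deg G y)) ⟩
        n + deg G x + weight y ∎)
        where open ≤-Reasoning
      heavier : total K < total (set K″ y true)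
      heavier = +-cancelʳ-< (weight z) _ _ (begin-strict
        total K + weight z                 <⟨ +-monoʳ-< (total K) z<xy ⟩
        total K + (weight x + weight y)    ≡⟨ +-assoc (total K) _ _ ⟨
        total K + weight x + weight y      ≡⟨ cong (_+ weight y) (swap-total Kz Kx) ⟨
        total K″ + weight z + weight y     ≡⟨ +-assoc (total K″) _ _ ⟩
        total K″ + (weight z + weight y)   ≡⟨ cong (total K″ +_) (+-comm (weight z) (weight y)) ⟩
        total K″ + (weight y + weight z)   ≡⟨ +-assoc (total K″) _ _ ⟨
        total K″ + weight y + weight z     ≡⟨ cong (_+ weight z) (total-insert K″ y K″y) ⟨
        total (set K″ y true) + weight z   ∎)
        where open ≤-Reasoning

    -- If `y` has larger degree than `v`, replacing `v` by `y` pays, and a clique vertex `w`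
    -- preventing it would complete a 2K₂ or a C₄. Otherwise `x`, a neighbour of `y` but not of `v`,
    -- is matched by a neighbour `t` of `v` but not of `y`; the adjacencies of `t` to `x` and `u`
    -- then yield 2K₂, C₄ or C₅.
    heavier-swap : ∀ {x y u v} → K x ≡ false → K y ≡ false → K u ≡ true → K v ≡ true → u ≢ v →
      E G x y ≡ true → E G x u ≡ false → E G y v ≡ false → E G x v ≡ false → E G y u ≡ true → Heavier K
    heavier-swap {x} {y} {u} {v} Kx Ky Ku Kv u≢v xy xu yv xv yu with ≤-<-connex (deg G y) (deg G v)
    ... | inj₂ v<y = set (set K v false) y true , swap-clique complete ,
      +-cancelʳ-< (weight v) _ _ (subst (total K + weight v <_) (≡.sym (swap-total Kv Ky))
        (+-monoʳ-< (total K) (+-monoʳ-< (suc n) v<y)))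
      where
      complete : ∀ w → w ≢ v → K w ≡ true → E G y w ≡ true
      complete w w≢v Kw with w ≟ u | E G y w in yw | E G x w in xw
      ... | yes refl | _     | _     = trans (≡.sym yw) yu
      ... | no _     | true  | _     = refl
      ... | no w≢u   | false | false = ⊥-elim (no-2K₂ xy (clique v w (≢-sym w≢v) Kv Kw) xv yw xw yv)
      ... | no w≢u   | false | true  =
        ⊥-elim (no-C₄ (K-≢ Kx Ku) (K-≢ Ky Kw) xy yu (clique u w (≢-sym w≢u) Ku Kw) (s xw) xu yw)
    ... | inj₁ y≤v with count-exchange (E G y) (E G v) y≤v′ x (s xy) (s xv)
      where
      y≤v′ = ≡.subst₂ _≤_ (deg≡count G y) (deg≡count G v) y≤v
    ... | t , yt , vt with E G x t in xt | E G u t in ut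
    ... | false | _     = ⊥-elim (no-2K₂ xy vt xv yt xt yv)
    ... | true  | true  = ⊥-elim (no-C₄ (K-≢ Kx Ku) y≢t xy yu ut (s xt) xu yt)
      where
      y≢t : y ≢ t
      y≢t refl = true≢false vt (s yv)
    ... | true  | false = ⊥-elim (no-C₅ xy yu (clique u v u≢v Ku Kv) vt (s xt) xu xv yv yt ut)

    -- Suppose first that `x` misses some `u` and `y` misses a different `v` in the clique; then
    -- `xv` and `yu` decide the case. Otherwise `x` or `y` is adjacent to the whole clique and can
    -- be added, or both miss the same single vertex and can replace it.
    heavier-edge : ∀ {x y} → K x ≡ false → K y ≡ false → E G x y ≡ true → Heavier K
    heavier-edge {x} {y} Kx Ky xy
      with any? (λ u → any? λ v → ¬? (u ≟ v) ×-dec K u Bool.≟ true ×-dec K v Bool.≟ true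
                                  ×-dec E G x u Bool.≟ false ×-dec E G y v Bool.≟ false)
    ... | yes (u , v , u≢v , Ku , Kv , xu , yv) with E G x v in xv | E G y u in yu
    ...   | true  | true  = ⊥-elim (no-C₄ (K-≢ Kx Ku) (K-≢ Ky Kv) xy yu (clique u v u≢v Ku Kv) (s xv) xu yv)
    ...   | false | false = ⊥-elim (no-2K₂ xy (clique u v u≢v Ku Kv) xu yv xv yu)
    ...   | false | true  = heavier-swap Kx Ky Ku Kv u≢v xy xu yv xv yu
    ...   | true  | false = heavier-swap Ky Kx Kv Ku (≢-sym u≢v) (s xy) yv xu yu xv
    heavier-edge {x} {y} Kx Ky xy | no none
      with any? (λ u → K u Bool.≟ true ×-dec E G x u Bool.≟ false)
         | any? (λ v → K v Bool.≟ true ×-dec E G y v Bool.≟ false)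
    ... | no nox | _ = heavier-insert clique Kx λ u Ku → not-false λ xu → nox (u , Ku , xu)
    ... | yes _ | no noy = heavier-insert clique Ky λ v Kv → not-false λ yv → noy (v , Kv , yv)
    ... | yes (u , Ku , xu) | yes (v , Kv , yv) with u ≟ v
    ...   | no u≢v   = contradiction (u , v , u≢v , Ku , Kv , xu , yv) none
    ...   | yes refl = heavier-two Kx Ky Ku xy
      (λ w w≢u Kw → not-false λ xw → none (w , u , w≢u , Kw , Ku , xw , yv))
      (λ w w≢u Kw → not-false λ yw → none (u , w , ≢-sym w≢u , Ku , Kw , xu , yw))

  -- `fuel` bounds the weight that can still be gained. When no edge avoids the clique, its
  -- complement is independent.
  split-from : ∀ fuel K → Clique K → sum weight ≤ total K + fuel → IsSplit G
  split-from fuel K clique enough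
    with any? (λ x → any? λ y → K x Bool.≟ false ×-dec K y Bool.≟ false ×-dec E G x y Bool.≟ true)
  ... | no none = K , clique , λ i j Ki Kj → not-true λ ij → none (i , j , Ki , Kj , ij)
  ... | yes (x , y , Kx , Ky , xy) with heavier-edge clique Kx Ky xy
  split-from zero K clique enough | _ | K′ , _ , K<K′ =
    contradiction (≤-trans enough (≤-reflexive (+-identityʳ _))) (<⇒≱ (<-≤-trans K<K′ (total-≤ K′)))
  split-from (suc fuel) K clique enough | _ | K′ , clique′ , K<K′ =
    split-from fuel K′ clique′ (≤-trans enough (≤-trans (≤-reflexive (+-suc _ fuel)) (+-monoˡ-≤ fuel K<K′)))

  split : IsSplit G
  split = split-from (sum weight) (λ _ → false) (λ _ _ _ ()) (m≤n+m _ _)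

-- Induced paths on four vertices in split graphs

P4-reverse : ∀ {n} (G : Graph n) {a b c d} → InducedP4 G a b c d → InducedP4 G d c b a
P4-reverse G ((a≢b , a≢c , a≢d , b≢c , b≢d , c≢d) , (ab , bc , cd) , (ac , bd , ad)) =
  (≢-sym c≢d , ≢-sym b≢d , ≢-sym a≢d , ≢-sym b≢c , ≢-sym a≢c , ≢-sym a≢b) ,
  (edge-sym G cd , edge-sym G bc , edge-sym G ab) , (edge-sym G bd , edge-sym G ac , edge-sym G ad)

In4-reverse : ∀ {n} {x a b c d : Fin n} → In4 x a b c d → In4 x d c b a
In4-reverse (inj₁ e)               = inj₂ (inj₂ (inj₂ e))
In4-reverse (inj₂ (inj₁ e))        = inj₂ (inj₂ (inj₁ e))
In4-reverse (inj₂ (inj₂ (inj₁ e))) = inj₂ (inj₁ e)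
In4-reverse (inj₂ (inj₂ (inj₂ e))) = inj₁ e

SplitBy : ∀ {n} → Graph n → (Fin n → Bool) → Set
SplitBy G K =
    (∀ i j → i ≢ j → K i ≡ true → K j ≡ true → E G i j ≡ true)
  × (∀ i j → K i ≡ false → K j ≡ false → E G i j ≡ false)

≢-colour : ∀ {n} (K : Fin n → Bool) {i j} → K i ≡ false → K j ≡ true → i ≢ j
≢-colour K Ki Kj refl = true≢false Kj Ki

module P4InSplit {n : ℕ} (G : Graph n) (K : Fin n → Bool) (split : SplitBy G K) where

  private
    clique = proj₁ split
    independent = proj₂ split
    s : ∀ {i j b} → E G i j ≡ b → E G j i ≡ b
    s = edge-sym G

  outside : ∀ {i j} → i ≢ j → E G i j ≡ false → K j ≡ true → K i ≡ false
  outside i≢j ij Kj = not-true λ Ki → true≢false (clique _ _ i≢j Ki Kj) ij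

  inside : ∀ {i j} → E G i j ≡ true → K j ≡ false → K i ≡ true
  inside ij Kj = not-false λ Ki → true≢false ij (independent _ _ Ki Kj)

  -- Were `b` independent, its neighbours `a` and `c` would be clique vertices and hence adjacent.
  mid-colour : ∀ {a b c d} → InducedP4 G a b c d → K b ≡ true
  mid-colour ((a≢b , a≢c , _) , (ab , bc , cd) , (ac , bd , ad)) =
    not-false λ Kb → true≢false (clique _ _ a≢c (inside ab Kb) (inside (s bc) Kb)) ac

  end-colour : ∀ {a b c d} → InducedP4 G a b c d → K a ≡ false
  end-colour p@((_ , a≢c , _) , _ , (ac , _)) = outside a≢c ac (mid-colour (P4-reverse G p))

  -- The partition decides `yy′` and `xx′`, so two edges and two non-edges alternating between the
  -- sides always form an induced path. This turns switches into induced paths.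
  P4-from : ∀ {x y y′ x′} → K x ≡ false → K y ≡ true → K y′ ≡ true → K x′ ≡ false →
    E G x y ≡ true → E G x y′ ≡ false → E G x′ y ≡ false → E G x′ y′ ≡ true → InducedP4 G x y y′ x′
  P4-from Kx Ky Ky′ Kx′ xy xy′ x′y x′y′ =
    (≢-colour K Kx Ky , ≢-colour K Kx Ky′ , separated G xy x′y , y≢y′ ,
     ≢-sym (≢-colour K Kx′ Ky) , ≢-sym (≢-colour K Kx′ Ky′)) ,
    (xy , clique _ _ y≢y′ Ky Ky′ , s x′y′) , (xy′ , s x′y , independent _ _ Kx Kx′)
    where y≢y′ = separated G (s xy) (s xy′)

  SameMid : Set
  SameMid = ∀ {a b c d a′ c′ d′} → InducedP4 G a b c d → InducedP4 G a′ b c′ d′ → a ≡ a′ × c ≡ c′ × d ≡ d′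

  SameEnd : Set
  SameEnd = ∀ {a b c d b′ c′ d′} → InducedP4 G a b c d → InducedP4 G a b′ c′ d′ → b ≡ b′ × c ≡ c′ × d ≡ d′

  -- By colour, a common vertex is an end of both paths or an inner vertex of both; reversals then
  -- move it to the first or second place of each.
  reducible : SameMid → SameEnd → IsP4Reducible G
  reducible same-mid same-end v a b c d a′ b′ c′ d′ p v∈p p′ v∈p′ x = common p v∈p p′ v∈p′
    where
    rev = P4-reverse G
    SameSet : ∀ a b c d a′ b′ c′ d′ → Set
    SameSet a b c d a′ b′ c′ d′ = (In4 x a b c d → In4 x a′ b′ c′ d′) × (In4 x a′ b′ c′ d′ → In4 x a b c d)
    mid : ∀ {a b c d a′ c′ d′} → InducedP4 G a b c d → InducedP4 G a′ b c′ d′ → SameSet a b c d a′ b c′ d′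
    mid p p′ with same-mid p p′
    ... | refl , refl , refl = id , id
    end : ∀ {a b c d b′ c′ d′} → InducedP4 G a b c d → InducedP4 G a b′ c′ d′ → SameSet a b c d a b′ c′ d′
    end p p′ with same-end p p′
    ... | refl , refl , refl = id , id
    flipˡ : ∀ {a b c d a′ b′ c′ d′} → SameSet d c b a a′ b′ c′ d′ → SameSet a b c d a′ b′ c′ d′
    flipˡ (f , g) = f ∘ In4-reverse , In4-reverse ∘ g
    flipʳ : ∀ {a b c d a′ b′ c′ d′} → SameSet a b c d d′ c′ b′ a′ → SameSet a b c d a′ b′ c′ d′
    flipʳ (f , g) = In4-reverse ∘ f , g ∘ In4-reverse
    from-end : ∀ {a b c d a′ b′ c′ d′} → InducedP4 G a b c d → InducedP4 G a′ b′ c′ d′ →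
      In4 a a′ b′ c′ d′ → SameSet a b c d a′ b′ c′ d′
    from-end p p′ (inj₁ refl)               = end p p′
    from-end p p′ (inj₂ (inj₁ refl))        = ⊥-elim (true≢false (mid-colour p′) (end-colour p))
    from-end p p′ (inj₂ (inj₂ (inj₁ refl))) = ⊥-elim (true≢false (mid-colour (rev p′)) (end-colour p))
    from-end p p′ (inj₂ (inj₂ (inj₂ refl))) = flipʳ (end p (rev p′))
    from-mid : ∀ {a b c d a′ b′ c′ d′} → InducedP4 G a b c d → InducedP4 G a′ b′ c′ d′ →
      In4 b a′ b′ c′ d′ → SameSet a b c d a′ b′ c′ d′
    from-mid p p′ (inj₁ refl)               = ⊥-elim (true≢false (mid-colour p) (end-colour p′))
    from-mid p p′ (inj₂ (inj₁ refl))        = mid p p′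
    from-mid p p′ (inj₂ (inj₂ (inj₁ refl))) = flipʳ (mid p (rev p′))
    from-mid p p′ (inj₂ (inj₂ (inj₂ refl))) = ⊥-elim (true≢false (mid-colour p) (end-colour (rev p′)))
    common : ∀ {a b c d a′ b′ c′ d′} → InducedP4 G a b c d → In4 v a b c d →
      InducedP4 G a′ b′ c′ d′ → In4 v a′ b′ c′ d′ → SameSet a b c d a′ b′ c′ d′
    common p (inj₁ refl)               p′ v∈p′ = from-end p p′ v∈p′
    common p (inj₂ (inj₁ refl))        p′ v∈p′ = from-mid p p′ v∈p′
    common p (inj₂ (inj₂ (inj₁ refl))) p′ v∈p′ = flipˡ (from-mid (rev p) p′ v∈p′)
    common p (inj₂ (inj₂ (inj₂ refl))) p′ v∈p′ = flipˡ (from-end (rev p) p′ v∈p′)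

  module _ (red : IsP4Reducible G) where

    end-in : ∀ {x a b c d} → InducedP4 G a b c d → K x ≡ false → In4 x a b c d → x ≡ a ⊎ x ≡ d
    end-in p Kx (inj₁ e)                  = inj₁ e
    end-in p Kx (inj₂ (inj₁ refl))        = ⊥-elim (true≢false (mid-colour p) Kx)
    end-in p Kx (inj₂ (inj₂ (inj₁ refl))) = ⊥-elim (true≢false (mid-colour (P4-reverse G p)) Kx)
    end-in p Kx (inj₂ (inj₂ (inj₂ e)))    = inj₂ e

    mid-in : ∀ {x a b c d} → InducedP4 G a b c d → K x ≡ true → In4 x a b c d → x ≡ b ⊎ x ≡ c
    mid-in p Kx (inj₁ refl)               = ⊥-elim (true≢false Kx (end-colour p))
    mid-in p Kx (inj₂ (inj₁ e))           = inj₁ e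
    mid-in p Kx (inj₂ (inj₂ (inj₁ e)))    = inj₂ e
    mid-in p Kx (inj₂ (inj₂ (inj₂ refl))) = ⊥-elim (true≢false Kx (end-colour (P4-reverse G p)))

    -- Equal vertex sets and colours leave two candidates for each vertex. Adjacency to `b` tells
    -- the two ends apart.
    same-mid : SameMid
    same-mid {a} {b} {c} {d} {a′} {c′} {d′} p@(_ , (ab , _ , _) , (_ , bd , _)) p′@((_ , _ , _ , b≢c′ , _) , (a′b , _ , _) , (_ , bd′ , _)) =
      a≡ , c≡ , d≡
      where
      within : ∀ x → In4 x a′ b c′ d′ → In4 x a b c d
      within x = proj₂ (red b a b c d a′ b c′ d′ p (inj₂ (inj₁ refl)) p′ (inj₂ (inj₁ refl)) x)
      a≡ : a ≡ a′
      a≡ with end-in p (end-colour p′) (within a′ (inj₁ refl))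
      ... | inj₁ e    = ≡.sym e
      ... | inj₂ refl = ⊥-elim (true≢false a′b (s bd))
      c≡ : c ≡ c′
      c≡ with mid-in p (mid-colour (P4-reverse G p′)) (within c′ (inj₂ (inj₂ (inj₁ refl))))
      ... | inj₁ e = contradiction (≡.sym e) b≢c′
      ... | inj₂ e = ≡.sym e
      d≡ : d ≡ d′
      d≡ with end-in p (end-colour (P4-reverse G p′)) (within d′ (inj₂ (inj₂ (inj₂ refl))))
      ... | inj₁ refl = ⊥-elim (true≢false ab (s bd′))
      ... | inj₂ e    = ≡.sym e

    same-end : SameEnd
    same-end {a} {b} {c} {d} {b′} {c′} {d′} p@(_ , _ , (ac , _)) p′@(_ , (ab′ , _) , _)
      with mid-in p (mid-colour p′)
             (proj₂ (red a a b c d a b′ c′ d′ p (inj₁ refl) p′ (inj₁ refl) b′) (inj₂ (inj₁ refl)))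
    ... | inj₁ refl = refl , proj₂ (same-mid p p′)
    ... | inj₂ refl = ⊥-elim (true≢false ab′ ac)

-- From hypercubes to split P₄-reducible graphs

module _ {n : ℕ} {d : Vec ℕ n} (cube : IsHypercube (Realization d) _≈R_ AdjR) (R : Realization d) where

  open Hypercube cube

  hypercube-split : IsSplit (graph R)
  hypercube-split = FöldesHammer.split (graph R) (no-2K₂ R) (no-C₄ R) (no-C₅ R)

  module _ (K : Fin n → Bool) (split : SplitBy (graph R) K) where

    private
      G = graph R
      rev = P4-reverse G
      s : ∀ {i j b} → E G i j ≡ b → E G j i ≡ b
      s = edge-sym G
      separate = ≢-colour K

    open P4InSplit G K split using (mid-colour; end-colour; SameMid; SameEnd; reducible)

    -- Otherwise `a` and `x` are two neighbours of `b` that `c` lacks, while `d` is a neighbour of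
    -- `c` that `b` lacks.
    end-unique : ∀ {a b c d x} → InducedP4 G a b c d → K x ≡ false → E G x b ≡ true → E G x c ≡ false → x ≡ a
    end-unique {a} {b} {c} {d} {x} p@(_ , (ab , bc , cd) , (ac , bd , ad)) Kx xb xc with x ≟ a
    ... | yes e = e
    ... | no x≢a = ⊥-elim (no-unbalanced R x≢a (separate Kx (mid-colour (rev p))) (separate (end-colour p) (mid-colour (rev p)))
      (separate (end-colour (rev p)) (mid-colour p)) xb xc ab ac (s bd) (s cd))

    -- The same argument for the two ends: `b` and `y` would be neighbours of `a` but not of `d`,
    -- and `c` of `d` but not of `a`.
    mid-unique : ∀ {a b c d y} → InducedP4 G a b c d → K y ≡ true → E G a y ≡ true → E G d y ≡ false → y ≡ b
    mid-unique {a} {b} {c} {d} {y} p@(_ , (ab , bc , cd) , (ac , bd , ad)) Ky ay dy with y ≟ b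
    ... | yes e = e
    ... | no y≢b = ⊥-elim (no-unbalanced R y≢b (≢-sym (separate (end-colour (rev p)) Ky)) (≢-sym (separate (end-colour (rev p)) (mid-colour p)))
      (≢-sym (separate (end-colour p) (mid-colour (rev p)))) (s ay) (s dy) (s ab) bd (s ac) cd)

    -- For `c ≢ c′`, uniqueness of ends fixes the adjacency of each end that is not shared to the
    -- third vertex of the other path. Which ends coincide then selects the contradiction.
    hypercube-same-mid : SameMid
    hypercube-same-mid {a} {b} {c} {d} {a′} {c′} {d′}
      p@(_ , (ab , bc , cd) , (ac , bd , ad)) p′@(_ , (a′b , bc′ , cd′) , (ac′ , bd′ , ad′)) = by-cases (c ≟ c′) (a ≟ a′) (d ≟ d′)
      where
      Ka = end-colour p
      Kb = mid-colour p
      Kc = mid-colour (rev p)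
      Kd = end-colour (rev p)
      Ka′ = end-colour p′
      Kc′ = mid-colour (rev p′)
      Kd′ = end-colour (rev p′)
      a′c : a ≢ a′ → E G a′ c ≡ true
      a′c a≢a′ = not-false λ a′c → a≢a′ (≡.sym (end-unique p Ka′ a′b a′c))
      a-c′ : a ≢ a′ → E G a c′ ≡ true
      a-c′ a≢a′ = not-false λ ac′ → a≢a′ (end-unique p′ Ka ab ac′)
      dc′ : d ≢ d′ → E G d c′ ≡ false
      dc′ d≢d′ = not-true λ dc′ → d≢d′ (end-unique (rev p′) Kd dc′ (s bd))
      d′c : d ≢ d′ → E G d′ c ≡ false
      d′c d≢d′ = not-true λ d′c → d≢d′ (≡.sym (end-unique (rev p) Kd′ d′c (s bd′)))
      by-cases : Dec (c ≡ c′) → Dec (a ≡ a′) → Dec (d ≡ d′) → a ≡ a′ × c ≡ c′ × d ≡ d′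
      by-cases (yes refl) _ _ = ≡.sym (end-unique p Ka′ a′b ac′) , refl , ≡.sym (end-unique (rev p) Kd′ (s cd′) (s bd′))
      by-cases (no c≢c′) (yes refl) (yes refl) = contradiction (≡.sym (mid-unique (rev p) Kc′ (s cd′) ac′)) c≢c′
      by-cases (no c≢c′) (yes refl) (no d≢d′) = ⊥-elim (no-3K₂ R K Ka Kd Kd′ Kb Kc Kc′
        ab ac ac′
        (s bd) (s cd) (dc′ d≢d′)
        (s bd′) (d′c d≢d′) (s cd′))
      by-cases (no c≢c′) (no a≢a′) (yes refl) = ⊥-elim (no-C₆ R K Kd Ka Ka′ Kb Kc Kc′
        (s bd) (s cd) (s cd′)
        ab ac (a-c′ a≢a′)
        a′b (a′c a≢a′) ac′)
      -- `c` has the neighbours `a′` and `d` that `c′` lacks, and `c′` has the neighbour `a` that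
      -- `c` lacks.
      by-cases (no c≢c′) (no a≢a′) (no d≢d′) = ⊥-elim (no-unbalanced R
        (separated G a′b (s bd)) (separate Ka′ Kc′) (separate Kd Kc′) (separate Ka Kc)
        (a′c a≢a′) ac′ (s cd) (dc′ d≢d′) ac (a-c′ a≢a′))

    hypercube-same-end : SameEnd
    hypercube-same-end {a} {b} {c} {d} {b′} {c′} {d′}
      p@(_ , (ab , bc , cd) , (ac , bd , ad)) p′@(_ , (ab′ , bc′ , cd′) , (ac′ , bd′ , ad′)) = by-cases (b ≟ b′) (c ≟ c′)
      where
      Ka = end-colour p
      Kb = mid-colour p
      Kc = mid-colour (rev p)
      Kd = end-colour (rev p)
      Kb′ = mid-colour p′
      Kc′ = mid-colour (rev p′)
      Kd′ = end-colour (rev p′)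
      db′ : b ≢ b′ → E G d b′ ≡ true
      db′ b≢b′ = not-false λ db′ → b≢b′ (≡.sym (mid-unique p Kb′ ab′ db′))
      d′b : b ≢ b′ → E G d′ b ≡ true
      d′b b≢b′ = not-false λ d′b → b≢b′ (mid-unique p′ Kb ab d′b)
      by-cases : Dec (b ≡ b′) → Dec (c ≡ c′) → b ≡ b′ × c ≡ c′ × d ≡ d′
      by-cases (yes refl) _ = refl , proj₂ (hypercube-same-mid p p′)
      by-cases (no b≢b′) (yes refl) = ⊥-elim (no-C₆ R K Ka Kd Kd′ Kc Kb Kb′
        ac ab ab′
        (s cd) (s bd) (db′ b≢b′)
        (s cd′) (d′b b≢b′) (s bd′))
      -- `d` has the neighbours `c` and `b′` that `d′` lacks, and `d′` has the neighbour `c′` that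
      -- `d` lacks.
      by-cases (no b≢b′) (no c≢c′) = ⊥-elim (no-unbalanced R
        (≢-sym (separated G (s ab′) (s ac))) (≢-sym (separate Kd′ Kc)) (≢-sym (separate Kd′ Kb′)) (≢-sym (separate Kd Kc′))
        cd cd″ (s (db′ b≢b′)) bd′ c′d cd′)
        where
        cd″ : E G c d′ ≡ false
        cd″ = not-true λ cd″ → c≢c′ (mid-unique (rev p′) Kc (s cd″) ac)
        c′d : E G c′ d ≡ false
        c′d = not-true λ c′d → c≢c′ (≡.sym (mid-unique (rev p) Kc′ (s c′d) ac′))

    hypercube-reducible : IsP4Reducible G
    hypercube-reducible = reducible hypercube-same-mid hypercube-same-end

-- Split degree sequences

module _ {n : ℕ} (K : Fin n → Bool) where

  member : Bool → Fin n → Bool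
  member true  i = K i
  member false i = not (K i)

  block : Bool → Bool → Graph n → Fin n → Fin n → ℕ
  block κ μ X i j = ⟦ member κ i ∧ member μ j ∧ E X i j ⟧

  blockSum : Bool → Bool → Graph n → ℕ
  blockSum κ μ X = sum λ i → sum λ j → block κ μ X i j

  blockSum-sym : ∀ κ μ X → blockSum κ μ X ≡ blockSum μ κ X
  blockSum-sym κ μ X = trans (∑-comm (block κ μ X)) (sum-cong-≗ λ j → sum-cong-≗ λ i → cong ⟦_⟧ (swap-∧ j i))
    where
    swap-∧ : ∀ j i → member κ i ∧ member μ j ∧ E X i j ≡ member μ j ∧ member κ i ∧ E X j i
    swap-∧ j i rewrite Graph.sym X i j = begin
      member κ i ∧ member μ j ∧ E X j i   ≡⟨ Bool.∧-assoc (member κ i) _ _ ⟨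
      (member κ i ∧ member μ j) ∧ E X j i ≡⟨ cong (_∧ E X j i) (Bool.∧-comm (member κ i) _) ⟩
      (member μ j ∧ member κ i) ∧ E X j i ≡⟨ Bool.∧-assoc (member μ j) _ _ ⟩
      member μ j ∧ member κ i ∧ E X j i   ∎
      where open ≡-Reasoning

  degreeSum : Bool → Graph n → ℕ
  degreeSum κ X = sum λ i → if member κ i then deg X i else 0

  degreeSum-blocks : ∀ κ X → degreeSum κ X ≡ blockSum κ true X + blockSum κ false X
  degreeSum-blocks κ X = trans (sum-cong-≗ row) (∑-distrib-+ (λ i → sum (block κ true X i)) (λ i → sum (block κ false X i)))
    where
    cell : ∀ m k e → ⟦ m ∧ k ∧ e ⟧ + ⟦ m ∧ not k ∧ e ⟧ ≡ ⟦ m ∧ e ⟧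
    cell false _     _ = refl
    cell true  true  e = +-identityʳ _
    cell true  false e = refl
    masked : ∀ m i → (if m then deg X i else 0) ≡ sum λ j → ⟦ m ∧ E X i j ⟧
    masked true  i = deg≡count X i
    masked false i = ≡.sym (sum-replicate-zero n)
    row : ∀ i → (if member κ i then deg X i else 0) ≡ sum (block κ true X i) + sum (block κ false X i)
    row i = begin
      (if member κ i then deg X i else 0)                         ≡⟨ masked (member κ i) i ⟩
      (sum λ j → ⟦ member κ i ∧ E X i j ⟧)                        ≡⟨ sum-cong-≗ (λ j → cell (member κ i) (K j) (E X i j)) ⟨
      (sum λ j → block κ true X i j + block κ false X i j)        ≡⟨ ∑-distrib-+ (block κ true X i) (block κ false X i) ⟩
      sum (block κ true X i) + sum (block κ false X i)            ∎
      where open ≡-Reasoning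

  blockSum-mono-≤ : ∀ κ X Y → (∀ i j → block κ κ X i j ≤ block κ κ Y i j) → blockSum κ κ X ≤ blockSum κ κ Y
  blockSum-mono-≤ κ X Y X≤Y = sum-mono-≤ (λ i → sum (block κ κ X i)) (λ i → sum (block κ κ Y i)) λ i →
    sum-mono-≤ (block κ κ X i) (block κ κ Y i) (X≤Y i)

  blockSum-mono-< : ∀ κ X Y → (∀ i j → block κ κ X i j ≤ block κ κ Y i j) →
    ∀ i j → block κ κ X i j < block κ κ Y i j → blockSum κ κ X < blockSum κ κ Y
  blockSum-mono-< κ X Y X≤Y i j X<Y = sum-mono-< (λ i → sum (block κ κ X i)) (λ i → sum (block κ κ Y i))
    (λ i → sum-mono-≤ (block κ κ X i) (block κ κ Y i) (X≤Y i)) i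
    (sum-mono-< (block κ κ X i) (block κ κ Y i) (X≤Y i) j X<Y)

  module _ (G H : Graph n) (split : SplitBy G K) (same-deg : ∀ i → deg G i ≡ deg H i) where

    degreeSum-same : ∀ κ → degreeSum κ G ≡ degreeSum κ H
    degreeSum-same κ = sum-cong-≗ λ i → cong (if member κ i then_else 0) (same-deg i)

    -- In the degree sum over `K` minus that over the complement the mixed blocks cancel by
    -- symmetry. The difference of the two diagonal blocks is therefore determined by the degrees.
    block-balance : blockSum true true H + blockSum false false G ≡ blockSum true true G + blockSum false false H
    block-balance = +-cancelʳ-≡ (blockSum true false H + blockSum false true G) _ _ (begin
      (kkH + iiG) + (kiH + ikG) ≡⟨ shuffle kkH iiG kiH ikG ⟩
      (kkH + kiH) + (ikG + iiG) ≡⟨ cong₂ _+_ (trans (≡.sym (degreeSum-blocks true H)) (trans (≡.sym (degreeSum-same true)) (degreeSum-blocks true G)))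
                                            (trans (≡.sym (degreeSum-blocks false G)) (trans (degreeSum-same false) (degreeSum-blocks false H))) ⟩
      (kkG + kiG) + (ikH + iiH) ≡⟨ cong₂ (λ x y → (kkG + x) + (y + iiH)) (blockSum-sym true false G) (blockSum-sym false true H) ⟩
      (kkG + ikG) + (kiH + iiH) ≡⟨ shuffle′ kkG ikG kiH iiH ⟩
      (kkG + iiH) + (kiH + ikG) ∎)
      where
      open ≡-Reasoning
      open +-*-Solver using (solve; _:+_; _:=_)
      kkG = blockSum true true G
      kiG = blockSum true false G
      ikG = blockSum false true G
      iiG = blockSum false false G
      kkH = blockSum true true H
      kiH = blockSum true false H
      ikH = blockSum false true H
      iiH = blockSum false false H
      shuffle : ∀ a b c d → (a + b) + (c + d) ≡ (a + c) + (d + b)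
      shuffle = solve 4 (λ a b c d → (a :+ b) :+ (c :+ d) := (a :+ c) :+ (d :+ b)) refl
      shuffle′ : ∀ a b c d → (a + b) + (c + d) ≡ (a + d) + (c + b)
      shuffle′ = solve 4 (λ a b c d → (a :+ b) :+ (c :+ d) := (a :+ d) :+ (c :+ b)) refl

    block-≤ : ∀ i j → block true true H i j ≤ block true true G i j
    block-≤ i j with K i in Ki | K j in Kj
    ... | false | _     = z≤n
    ... | true  | false = z≤n
    ... | true  | true with i ≟ j
    ...   | yes refl rewrite irrefl H i = z≤n
    ...   | no i≢j rewrite proj₁ split i j i≢j Ki Kj = ⟦⟧≤1 _

    block-≥ : ∀ i j → block false false G i j ≤ block false false H i j
    block-≥ i j with K i in Ki | K j in Kj
    ... | true  | _     = z≤n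
    ... | false | true  = z≤n
    ... | false | false rewrite proj₂ split i j Ki Kj = z≤n

    -- In `G` the clique block is as large as possible and the independent block is zero, so a
    -- missing edge inside `K` or an edge of `H` outside it would make `block-balance` a strict
    -- inequality.
    same-split : SplitBy H K
    same-split = clique , independent
      where
      clique : ∀ i j → i ≢ j → K i ≡ true → K j ≡ true → E H i j ≡ true
      clique i j i≢j Ki Kj = not-false λ ij → <-irrefl block-balance (+-mono-<-≤
        (blockSum-mono-< true H G block-≤ i j (strict ij)) (blockSum-mono-≤ false G H block-≥))
        where
        strict : E H i j ≡ false → block true true H i j < block true true G i j
        strict ij rewrite Ki | Kj | ij | proj₁ split i j i≢j Ki Kj = ≤-refl
      independent : ∀ i j → K i ≡ false → K j ≡ false → E H i j ≡ false
      independent i j Ki Kj = not-true λ ij → <-irrefl block-balance (+-mono-≤-<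
        (blockSum-mono-≤ true H G block-≤) (blockSum-mono-< false G H block-≥ i j (strict ij)))
        where
        strict : E H i j ≡ true → block false false G i j < block false false H i j
        strict ij rewrite Ki | Kj | ij | proj₂ split i j Ki Kj = ≤-refl

argmin : ∀ {n} {P : Fin n → Set} → Decidable P → (f : Fin n → ℕ) → ∃ P → ∃[ y ] (P y × (∀ y′ → P y′ → f y ≤ f y′))
argmin {n} {P} P? f (y₀ , Py₀) = search (f y₀) y₀ Py₀ ≤-refl
  where
  search : ∀ k y → P y → f y ≤ k → ∃[ y ] (P y × (∀ y′ → P y′ → f y ≤ f y′))
  search k y Py fy≤k with any? (λ y′ → P? y′ ×-dec suc (f y′) ≤? f y)
  ... | no none = y , Py , λ y′ Py′ → ≮⇒≥ λ lt → none (y′ , Py′ , lt)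
  search zero    y Py fy≤k | yes (y′ , Py′ , lt) = contradiction (≤-trans lt fy≤k) λ ()
  search (suc k) y Py fy≤k | yes (y′ , Py′ , lt) = search k y′ Py′ (≤-pred (≤-trans lt fy≤k))

-- Exchanging the inner vertices of an induced path

relabel : ∀ {n} → Graph n → Fin n → Fin n → Graph n
E (relabel X p q) i j = E X (transpose p q i) (transpose p q j)
Graph.sym (relabel X p q) i j = Graph.sym X _ _
irrefl (relabel X p q) i = irrefl X _

module UniquePaths {n : ℕ} (X : Graph n) (K : Fin n → Bool) (split : SplitBy X K)
  (same-mid : P4InSplit.SameMid X K split) where

  open P4InSplit X K split using (mid-colour; end-colour; P4-from; outside; inside)

  private
    rev = P4-reverse X
    s : ∀ {i j b} → E X i j ≡ b → E X j i ≡ b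
    s = edge-sym X

  -- A clique vertex is adjacent to both. An independent vertex adjacent to only one of them could
  -- replace `x` or `x′` in the path, against `same-mid`.
  homogeneous : ∀ {x y y′ x′ v} → InducedP4 X x y y′ x′ → v ≢ x → v ≢ x′ → v ≢ y → v ≢ y′ → E X v y ≡ E X v y′
  homogeneous {x} {y} {y′} {x′} {v} p@(_ , (xy , _ , y′x′) , (xy′ , yx′ , _)) v≢x v≢x′ v≢y v≢y′
    with K v in Kv | E X v y in vy | E X v y′ in vy′
  ... | true  | _     | _     = trans (≡.sym vy) (trans (proj₁ split v y v≢y Kv (mid-colour p))
                                  (trans (≡.sym (proj₁ split v y′ v≢y′ Kv (mid-colour (rev p)))) vy′))
  ... | false | true  | true  = refl
  ... | false | false | false = refl
  ... | false | true  | false = contradiction (proj₁ (same-mid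
          (P4-from Kv (mid-colour p) (mid-colour (rev p)) (end-colour (rev p)) vy vy′ (s yx′) (s y′x′)) p)) v≢x
  ... | false | false | true  = contradiction (proj₁ (same-mid
          (P4-from Kv (mid-colour (rev p)) (mid-colour p) (end-colour p) vy′ vy xy′ xy) (rev p))) v≢x′

  relabel-switch : ∀ {x y y′ x′} → InducedP4 X x y y′ x′ → TwoSwitch X (relabel X y y′)
  relabel-switch {x} {y} {y′} {x′} p@((x≢y , x≢y′ , x≢x′ , y≢y′ , y≢x′ , y′≢x′) , (xy , yy′ , y′x′) , (xy′ , yx′ , xx′)) =
    x , y , x′ , y′ , (x≢y , x≢x′ , x≢y′ , y≢x′ , y≢y′ , ≢-sym y′≢x′) , (xy , s y′x′ , xy′ , yx′) ,
    both (trans (cong₂ (E X) τx τy) xy′) , both (trans (cong₂ (E X) τx′ τy′) (s yx′)) ,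
    both (trans (cong₂ (E X) τx τy′) xy) , both (trans (cong₂ (E X) τy τx′) y′x′) , unchanged
    where
    τ = transpose y y′
    Y = relabel X y y′
    τx : τ x ≡ x
    τx = transpose-fix y y′ x≢y x≢y′
    τx′ : τ x′ ≡ x′
    τx′ = transpose-fix y y′ (≢-sym y≢x′) (≢-sym y′≢x′)
    τy : τ y ≡ y′
    τy = transpose-l y y′
    τy′ : τ y′ ≡ y
    τy′ = transpose-r y y′
    both : ∀ {p q b} → E Y p q ≡ b → ∀ i j → SamePair i j p q → E Y i j ≡ b
    both pq i j (inj₁ (refl , refl)) = pq
    both pq i j (inj₂ (refl , refl)) = trans (Graph.sym Y i j) pq
    -- The columns move along with the rows: at `y` a diagonal entry meets a diagonal entry, and at
    -- `y′` the edge `yy′` meets itself.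
    row : ∀ j → j ≢ x → j ≢ x′ → E X y′ (τ j) ≡ E X y j
    row j j≢x j≢x′ = transpose-elim y y′ (λ k k′ → (k ≢ x × k ≢ x′) → E X y′ k′ ≡ E X y k)
      (λ _ → trans (irrefl X y′) (≡.sym (irrefl X y))) (λ _ → Graph.sym X y′ y)
      (λ k k≢y k≢y′ (k≢x , k≢x′) → trans (Graph.sym X y′ k) (trans (≡.sym (homogeneous p k≢x k≢x′ k≢y k≢y′)) (Graph.sym X k y))) j (j≢x , j≢x′)
    row′ : ∀ j → j ≢ x → j ≢ x′ → E X y (τ j) ≡ E X y′ j
    row′ j j≢x j≢x′ = transpose-elim y y′ (λ k k′ → (k ≢ x × k ≢ x′) → E X y k′ ≡ E X y′ k)
      (λ _ → Graph.sym X y y′) (λ _ → trans (irrefl X y) (≡.sym (irrefl X y′)))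
      (λ k k≢y k≢y′ (k≢x , k≢x′) → trans (Graph.sym X y k) (trans (homogeneous p k≢x k≢x′ k≢y k≢y′) (Graph.sym X k y′))) j (j≢x , j≢x′)
    unchanged : ∀ i j → ¬ SamePair i j x y → ¬ SamePair i j x′ y′ → ¬ SamePair i j x y′ → ¬ SamePair i j y x′ →
      E Y i j ≡ E X i j
    unchanged i j ¬xy ¬x′y′ ¬xy′ ¬yx′ = by-cases (i ≟ y) (i ≟ y′) (j ≟ y) (j ≟ y′)
      where
      by-cases : Dec (i ≡ y) → Dec (i ≡ y′) → Dec (j ≡ y) → Dec (j ≡ y′) → E Y i j ≡ E X i j
      by-cases (yes refl) _ _ _ = trans (cong (λ t → E X t (τ j)) τy)
        (row j (λ e → ¬xy (inj₂ (refl , e))) (λ e → ¬yx′ (inj₁ (refl , e))))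
      by-cases _ (yes refl) _ _ = trans (cong (λ t → E X t (τ j)) τy′)
        (row′ j (λ e → ¬xy′ (inj₂ (refl , e))) (λ e → ¬x′y′ (inj₂ (refl , e))))
      by-cases _ _ (yes refl) _ = trans (Graph.sym X _ _) (trans (cong (λ t → E X t (τ i)) τy)
        (trans (row i (λ e → ¬xy (inj₁ (e , refl))) (λ e → ¬yx′ (inj₂ (e , refl)))) (Graph.sym X _ _)))
      by-cases _ _ _ (yes refl) = trans (Graph.sym X _ _) (trans (cong (λ t → E X t (τ i)) τy′)
        (trans (row′ i (λ e → ¬xy′ (inj₁ (e , refl))) (λ e → ¬x′y′ (inj₁ (e , refl)))) (Graph.sym X _ _)))
      by-cases (no i≢y) (no i≢y′) (no j≢y) (no j≢y′) =
        cong₂ (E X) (transpose-fix y y′ i≢y i≢y′) (transpose-fix y y′ j≢y j≢y′)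

  -- Relabelling gives `y` the degree of `y′`; being a switch, it also preserves the degree of `y`.
  mid-deg : ∀ {x y y′ x′} → InducedP4 X x y y′ x′ → deg X y′ ≡ deg X y
  mid-deg {_} {y} {y′} p = trans
    (deg-transpose X Y y y′ y′ y λ j → cong (λ t → E X t (transpose y y′ j)) (transpose-l y y′))
    (≡.sym (TwoSwitch-deg X Y (relabel-switch p) y))
    where Y = relabel X y y′

  module Compare (H : Graph n) (split-H : SplitBy H K) (same-deg : ∀ i → deg X i ≡ deg H i) where

    -- All four pairs are recorded because the path may run in either direction and orientation
    -- along a listed one: whichever pair `bit` reads, it is among them.
    Opposite : Set
    Opposite = ∃[ x ] ∃[ y ] ∃[ y′ ] ∃[ x′ ] (InducedP4 X x y y′ x′ ×
      E H x y ≡ false × E H x y′ ≡ true × E H x′ y′ ≡ false × E H x′ y ≡ true)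

    same-count : ∀ i → count (E X i) ≡ count (E H i)
    same-count i = trans (≡.sym (deg≡count X i)) (trans (same-deg i) (deg≡count H i))

    Differs : Fin n → Set
    Differs y = ∃[ x ] E X y x ≢ E H y x

    Candidate : Fin n → Set
    Candidate y = K y ≡ true × Differs y

    candidate? : Decidable Candidate
    candidate? y = K y Bool.≟ true ×-dec any? λ x → ¬? (E X y x Bool.≟ E H y x)

    lost : ∀ {y} → Differs y → ∃[ x ] (E X y x ≡ true × E H y x ≡ false)
    lost {y} (x , ne) with E X y x in Xyx | E H y x in Hyx
    ... | true  | true  = contradiction refl ne
    ... | false | false = contradiction refl ne
    ... | true  | false = x , Xyx , Hyx
    ... | false | true with count-exchange (E H y) (E X y) (≤-reflexive (≡.sym (same-count y))) x Hyx Xyx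
    ...   | z , Hyz , Xyz = z , Xyz , Hyz

    -- As deg y ≤ deg y′, some x′ is adjacent to y′ but not to y; comparing with the
    -- transposed row of y′ rules out x′ ∈ {y , y′}.
    extend : ∀ {y} → Candidate y → (∀ y′ → Candidate y′ → deg X y ≤ deg X y′) →
      ∃[ x ] ∃[ y′ ] ∃[ x′ ] (InducedP4 X x y y′ x′ × E H x y ≡ false × E H x y′ ≡ true)
    extend {y} (Ky , differs) minimal with lost differs
    ... | x , yx , Hyx with count-exchange (E X x) (E H x) (≤-reflexive (same-count x)) y (s yx) (edge-sym H Hyx)
    ... | y′ , xy′ , Hxy′ = x , y′ , proj₁ fourth , proj₂ fourth , edge-sym H Hyx , Hxy′
      where
      x≢y : x ≢ y
      x≢y = ≢-sym (edge-≢ X yx)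
      Kx : K x ≡ false
      Kx = not-true λ Kx → true≢false (proj₁ split-H y x (≢-sym x≢y) Ky Kx) Hyx
      Ky′ : K y′ ≡ true
      Ky′ = not-false λ Ky′ → true≢false Hxy′ (proj₂ split-H x y′ Kx Ky′)
      y≢y′ : y ≢ y′
      y≢y′ = separated X yx (s xy′)
      y≤y′ : deg X y ≤ deg X y′
      y≤y′ = minimal y′ (Ky′ , x , λ e → true≢false (trans e (edge-sym H Hxy′)) (s xy′))
      τ = transpose y y′
      y≤y′∘τ : count (E X y) ≤ count (E X y′ ∘ τ)
      y≤y′∘τ = begin
        count (E X y)       ≡⟨ deg≡count X y ⟨
        deg X y             ≤⟨ y≤y′ ⟩
        deg X y′            ≡⟨ deg≡count X y′ ⟩
        count (E X y′)      ≡⟨ sum-involution _ τ (transpose-involutive y y′) ⟩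
        count (E X y′ ∘ τ)  ∎
        where open ≤-Reasoning
      fourth : ∃[ x′ ] InducedP4 X x y y′ x′
      fourth with count-exchange (E X y) (E X y′ ∘ τ) y≤y′∘τ x yx
                    (trans (cong (E X y′) (transpose-fix y y′ x≢y (≢-colour K Kx Ky′))) (s xy′))
      ... | x′ , yx′ , y′τx′ = x′ , P4-from Kx Ky Ky′ Kx′ (s yx) xy′ (s yx′) (s y′x′)
        where
        x′≢y : x′ ≢ y
        x′≢y refl = true≢false y′τx′ (trans (cong (E X y′) (transpose-l y y′)) (irrefl X y′))
        x′≢y′ : x′ ≢ y′
        x′≢y′ refl = true≢false y′τx′ (trans (cong (E X y′) (transpose-r y y′)) (s yx′))
        y′x′ : E X y′ x′ ≡ true
        y′x′ = trans (cong (E X y′) (≡.sym (transpose-fix y y′ x′≢y x′≢y′))) y′τx′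
        Kx′ : K x′ ≡ false
        Kx′ = outside x′≢y (s yx′) Ky

    -- `extend` at `y` gives the two pairs at `x`. By `mid-deg` the vertex `y′` is a candidate of
    -- least degree too; the path found from `y′` is the same one reversed, by `same-mid`, and
    -- supplies the pairs at `x′`.
    opposite : ∃ Candidate → Opposite
    opposite found = complete (extend candidate minimal)
      where
      least = argmin candidate? (deg X) found
      y = proj₁ least
      candidate = proj₁ (proj₂ least)
      minimal = proj₂ (proj₂ least)
      close : ∀ {x y′ x′ z y″ z′} → InducedP4 X x y y′ x′ → E H x y ≡ false → E H x y′ ≡ true →
        InducedP4 X z y′ y″ z′ → E H z y′ ≡ false → E H z y″ ≡ true → x′ ≡ z × y ≡ y″ × x ≡ z′ → Opposite
      close p Hxy Hxy′ _ Hx′y′ Hx′y (refl , refl , refl) = _ , y , _ , _ , p , Hxy , Hxy′ , Hx′y′ , Hx′y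
      complete : ∃[ x ] ∃[ y′ ] ∃[ x′ ] (InducedP4 X x y y′ x′ × E H x y ≡ false × E H x y′ ≡ true) → Opposite
      complete (x , y′ , x′ , p@(_ , _ , (xy′ , _)) , Hxy , Hxy′) =
        let z , y″ , z′ , q , Hzy′ , Hzy″ = extend candidate′ minimal′
        in close p Hxy Hxy′ q Hzy′ Hzy″ (same-mid (rev p) q)
        where
        candidate′ : Candidate y′
        candidate′ = mid-colour (rev p) , x , λ e → true≢false (trans e (edge-sym H Hxy′)) (s xy′)
        minimal′ : ∀ z → Candidate z → deg X y′ ≤ deg X z
        minimal′ z cz = ≤-trans (≤-reflexive (mid-deg p)) (minimal z cz)

    compare : X ≈E H ⊎ Opposite
    compare with any? candidate?
    ... | yes found = inj₂ (opposite found)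
    ... | no none   = inj₁ agree
      where
      agree-K : ∀ i j → K i ≡ true → E X i j ≡ E H i j
      agree-K i j Ki with E X i j Bool.≟ E H i j
      ... | yes e = e
      ... | no ¬e = contradiction (i , Ki , j , ¬e) none
      agree : X ≈E H
      agree i j with K i in Ki | K j in Kj
      ... | true  | _     = agree-K i j Ki
      ... | false | true  = trans (Graph.sym X i j) (trans (agree-K j i Kj) (Graph.sym H j i))
      ... | false | false = trans (proj₂ split i j Ki Kj) (≡.sym (proj₂ split-H i j Ki Kj))

-- The hypercube of realizations

enumerate : ∀ {n} {P : Fin n → Set} → Decidable P → ∃[ m ] Σ (Fin m → Fin n) λ e →
  (∀ j → P (e j)) × (∀ {i j} → e i ≡ e j → i ≡ j) × (∀ x → P x → ∃[ j ] e j ≡ x)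
enumerate {zero} P? = 0 , (λ ()) , (λ ()) , (λ {}) , λ ()
enumerate {suc n} {P} P? with enumerate (P? ∘ suc) | P? zero
... | m , e , Pe , inj , surj | no ¬P0 = m , suc ∘ e , Pe , inj ∘ Fin.suc-injective , surj′
  where
  surj′ : ∀ x → P x → ∃[ j ] suc (e j) ≡ x
  surj′ zero    Px = contradiction Px ¬P0
  surj′ (suc x) Px = let j , eq = surj x Px in j , cong suc eq
... | m , e , Pe , inj , surj | yes P0 = suc m , e′ , Pe′ , inj′ , surj′
  where
  e′ : Fin (suc m) → Fin (suc n)
  e′ zero    = zero
  e′ (suc j) = suc (e j)
  Pe′ : ∀ j → P (e′ j)
  Pe′ zero    = P0
  Pe′ (suc j) = Pe j
  inj′ : ∀ {i j} → e′ i ≡ e′ j → i ≡ j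
  inj′ {zero}  {zero}  _  = refl
  inj′ {suc i} {suc j} eq = cong suc (inj (Fin.suc-injective eq))
  surj′ : ∀ x → P x → ∃[ j ] e′ j ≡ x
  surj′ zero    Px = zero , refl
  surj′ (suc x) Px = let j , eq = surj x Px in suc j , cong suc eq

inducedP4? : ∀ {n} (G : Graph n) a b c d → Dec (InducedP4 G a b c d)
inducedP4? G a b c d =
  (¬? (a ≟ b) ×-dec ¬? (a ≟ c) ×-dec ¬? (a ≟ d) ×-dec ¬? (b ≟ c) ×-dec ¬? (b ≟ d) ×-dec ¬? (c ≟ d))
  ×-dec (E G a b Bool.≟ true ×-dec E G b c Bool.≟ true ×-dec E G c d Bool.≟ true)
  ×-dec (E G a c Bool.≟ false ×-dec E G b d Bool.≟ false ×-dec E G a d Bool.≟ false)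

P4-cong : ∀ {n} (X : Graph n) {a b c d a′ b′ c′ d′} → a ≡ a′ → b ≡ b′ → c ≡ c′ → d ≡ d′ →
  InducedP4 X a b c d → InducedP4 X a′ b′ c′ d′
P4-cong X refl refl refl refl p = p

P4-transport : ∀ {n} {X Y : Graph n} → X ≈E Y → ∀ {a b c d} → InducedP4 X a b c d → InducedP4 Y a b c d
P4-transport X≈Y (ne , (ab , bc , cd) , (ac , bd , ad)) =
  ne , (move ab , move bc , move cd) , (move ac , move bd , move ad)
  where
  move : ∀ {i j b} → _ ≡ b → _ ≡ b
  move {i} {j} e = trans (≡.sym (X≈Y i j)) e

TwoSwitch-transport : ∀ {n} {X Y Z : Graph n} → Y ≈E Z → TwoSwitch X Y → TwoSwitch X Z
TwoSwitch-transport {n} {X} {Y} {Z} Y≈Z (a , b , c , d , ne , edges , ab , cd , ad , bc , rest) =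
  a , b , c , d , ne , edges , (λ i j s → move i j (ab i j s)) , (λ i j s → move i j (cd i j s)) ,
  (λ i j s → move i j (ad i j s)) , (λ i j s → move i j (bc i j s)) ,
  λ i j s₁ s₂ s₃ s₄ → move i j (rest i j s₁ s₂ s₃ s₄)
  where
  move : ∀ i j {e} → E Y i j ≡ e → E Z i j ≡ e
  move i j eq = trans (≡.sym (Y≈Z i j)) eq

module _ {n : ℕ} (X : Graph n) (p q : Fin n) where

  private τ = transpose p q

  P4-relabel : ∀ {a b c d} → InducedP4 X (τ a) (τ b) (τ c) (τ d) → InducedP4 (relabel X p q) a b c d
  P4-relabel ((ab , ac , ad , bc , bd , cd) , rest) =
    (ab ∘ cong τ , ac ∘ cong τ , ad ∘ cong τ , bc ∘ cong τ , bd ∘ cong τ , cd ∘ cong τ) , rest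

  P4-unlabel : ∀ {a b c d} → InducedP4 (relabel X p q) a b c d → InducedP4 X (τ a) (τ b) (τ c) (τ d)
  P4-unlabel ((ab , ac , ad , bc , bd , cd) , rest) = (ab ∘ inj , ac ∘ inj , ad ∘ inj , bc ∘ inj , bd ∘ inj , cd ∘ inj) , rest
    where
    inj : ∀ {i j} → τ i ≡ τ j → i ≡ j
    inj {i} {j} e = trans (≡.sym (transpose-involutive p q i)) (trans (cong τ e) (transpose-involutive p q j))

SamePair-unique : ∀ {n} {y z z′ b c : Fin n} → SamePair y z b c → SamePair y z′ b c → z ≡ z′
SamePair-unique (inj₁ (refl , refl)) (inj₁ (_    , refl)) = refl
SamePair-unique (inj₁ (refl , refl)) (inj₂ (refl , refl)) = refl
SamePair-unique (inj₂ (refl , refl)) (inj₁ (refl , refl)) = refl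
SamePair-unique (inj₂ (refl , refl)) (inj₂ (_    , refl)) = refl

SamePair-compare : ∀ {n} {x w x′ w′ a d : Fin n} → SamePair x w a d → SamePair x′ w′ a d →
  (x ≡ x′ × w ≡ w′) ⊎ x ≡ w′
SamePair-compare (inj₁ (refl , refl)) (inj₁ (refl , refl)) = inj₁ (refl , refl)
SamePair-compare (inj₁ (refl , refl)) (inj₂ (refl , refl)) = inj₂ refl
SamePair-compare (inj₂ (refl , refl)) (inj₁ (refl , refl)) = inj₂ refl
SamePair-compare (inj₂ (refl , refl)) (inj₂ (refl , refl)) = inj₁ (refl , refl)

-- The induced paths of G, each listed once as a j – b j – c j – d j with b j < c j.
record PathList {n : ℕ} (G : Graph n) : Set where
  field
    m           : ℕ
    a b c d     : Fin m → Fin n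
    path        : ∀ j → InducedP4 G (a j) (b j) (c j) (d j)
    b<c         : ∀ j → b j Fin.< c j
    b-injective : ∀ {i j} → b i ≡ b j → i ≡ j
    b-covers    : ∀ {x y z w} → InducedP4 G x y z w → y Fin.< z → ∃[ j ] b j ≡ y

-- Indexing by the smaller inner vertex selects one direction of each path. Under `SameMid` the path
-- found for `b` is the only one.
pathList : ∀ {n} (G : Graph n) → PathList G
pathList G with enumerate (λ b → any? λ a → any? λ c → any? λ d → inducedP4? G a b c d ×-dec b Fin.<? c)
... | m , b , start , b-injective , b-covers = record
  { m           = m
  ; a           = λ j → proj₁ (start j)
  ; b           = b
  ; c           = λ j → proj₁ (proj₂ (start j))
  ; d           = λ j → proj₁ (proj₂ (proj₂ (start j)))
  ; path        = λ j → proj₁ (proj₂ (proj₂ (proj₂ (start j))))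
  ; b<c         = λ j → proj₂ (proj₂ (proj₂ (proj₂ (start j))))
  ; b-injective = b-injective
  ; b-covers    = λ p y<z → b-covers _ (_ , _ , _ , p , y<z)
  }

-- Realizations obtained by flipping the listed paths

module Converse {n : ℕ} {deg-seq : Vec ℕ n} (R : Realization deg-seq) (K : Fin n → Bool)
  (split : SplitBy (graph R) K) (red : IsP4Reducible (graph R)) (paths : PathList (graph R)) where

  private
    G = graph R

  open P4InSplit G K split using (mid-colour; end-colour) renaming (same-mid to G-same-mid; same-end to G-same-end)
  open PathList paths

  reversed-path : ∀ j → InducedP4 G (d j) (c j) (b j) (a j)
  reversed-path j = P4-reverse G (path j)

  Ka : ∀ j → K (a j) ≡ false
  Ka j = end-colour (path j)
  Kb : ∀ j → K (b j) ≡ true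
  Kb j = mid-colour (path j)
  Kc : ∀ j → K (c j) ≡ true
  Kc j = mid-colour (reversed-path j)
  Kd : ∀ j → K (d j) ≡ false
  Kd j = end-colour (reversed-path j)

  -- Otherwise path `j` is path `k` reversed, and `b j < c j = b k < c k = b j`.
  b≢c : ∀ {j k} → b j ≢ c k
  b≢c {j} {k} e = Fin.<-asym (b<c j) (subst₂ Fin._<_ (≡.sym c≡b) (≡.sym e) (b<c k))
    where
    c≡b : c j ≡ b k
    c≡b = proj₁ (proj₂ (G-same-mid red (path j) (P4-cong G refl (≡.sym e) refl refl (reversed-path k))))

  c-injective : ∀ {j k} → c j ≡ c k → j ≡ k
  c-injective {j} {k} e = b-injective (proj₁ (proj₂ (G-same-mid red (reversed-path j) (P4-cong G refl (≡.sym e) refl refl (reversed-path k)))))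

  a-injective : ∀ {j k} → a j ≡ a k → j ≡ k
  a-injective {j} {k} e = b-injective (proj₁ (G-same-end red (path j) (P4-cong G (≡.sym e) refl refl refl (path k))))

  a≢d : ∀ {j k} → a j ≢ d k
  a≢d {j} {k} e = b≢c (proj₁ (G-same-end red (path j) (P4-cong G (≡.sym e) refl refl refl (reversed-path k))))

  OnPath : Fin m → (x y z w : Fin n) → Set
  OnPath j x y z w = SamePair y z (b j) (c j) × SamePair x w (a j) (d j)

  listed : ∀ {x y z w} → InducedP4 G x y z w → ∃[ j ] OnPath j x y z w
  listed {x} {y} {z} {w} p@((_ , _ , _ , y≢z , _) , _) with Fin.<-cmp y z
  ... | tri≈ _ y≡z _ = contradiction y≡z y≢z
  ... | tri< y<z _ _ with b-covers p y<z
  ...   | j , refl with G-same-mid red (path j) p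
  ...     | refl , refl , refl = j , inj₁ (refl , refl) , inj₁ (refl , refl)
  listed {x} {y} {z} {w} p | tri> _ _ z<y with b-covers (P4-reverse G p) z<y
  ...   | j , refl with G-same-mid red (path j) (P4-reverse G p)
  ...     | refl , refl , refl = j , inj₂ (refl , refl) , inj₂ (refl , refl)

  mid-index : ∀ {y z z′ j k} → SamePair y z (b j) (c j) → SamePair y z′ (b k) (c k) → j ≡ k
  mid-index (inj₁ (refl , _)) (inj₁ (e , _)) = b-injective e
  mid-index (inj₁ (refl , _)) (inj₂ (e , _)) = contradiction e b≢c
  mid-index (inj₂ (refl , _)) (inj₁ (e , _)) = contradiction (≡.sym e) b≢c
  mid-index (inj₂ (refl , _)) (inj₂ (e , _)) = c-injective e

  end-index : ∀ {x w j k} → SamePair x w (a j) (d j) → a k ≡ x ⊎ a k ≡ w → k ≡ j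
  end-index (inj₁ (refl , _)) (inj₁ e) = a-injective e
  end-index (inj₁ (_ , refl)) (inj₂ e) = contradiction e a≢d
  end-index (inj₂ (refl , _)) (inj₁ e) = contradiction e a≢d
  end-index (inj₂ (_ , refl)) (inj₂ e) = a-injective e

  -- The part of the structure of `G` that flips preserve: each listed path persists up to an
  -- exchange of its ends, and every induced path has the inner vertices and the ends of a listed
  -- one.
  record Good (X : Graph n) : Set where
    field
      split-X  : SplitBy X K
      oriented : ∀ j → InducedP4 X (a j) (b j) (c j) (d j) ⊎ InducedP4 X (d j) (b j) (c j) (a j)
      on-path  : ∀ {x y z w} → InducedP4 X x y z w → ∃[ j ] OnPath j x y z w

    -- A common inner vertex gives both paths the same index. Their ends can then only be equal or
    -- exchanged, and an exchange would make `x` both adjacent and non-adjacent to `y`.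
    same-mid : P4InSplit.SameMid X K split-X
    same-mid p@(_ , (xy , _) , _) p′@(_ , _ , (_ , yw′ , _)) with on-path p | on-path p′
    ... | j , yz , xw | k , yz′ , xw′ with mid-index yz yz′
    ... | refl with SamePair-compare xw xw′
    ... | inj₁ (x≡x′ , w≡w′) = x≡x′ , SamePair-unique yz yz′ , w≡w′
    ... | inj₂ refl = ⊥-elim (true≢false xy (edge-sym X yw′))

  good-G : Good G
  good-G = record { split-X = split ; oriented = inj₁ ∘ path ; on-path = listed }

  good-transport : ∀ {X Y} → X ≈E Y → Good X → Good Y
  good-transport {X} {Y} X≈Y good = record
    { split-X  = (λ i j i≢j Ki Kj → trans (≡.sym (X≈Y i j)) (proj₁ split-X i j i≢j Ki Kj))
               , (λ i j Ki Kj → trans (≡.sym (X≈Y i j)) (proj₂ split-X i j Ki Kj))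
    ; oriented = λ j → [ inj₁ ∘ P4-transport {X = X} {Y} X≈Y , inj₂ ∘ P4-transport {X = X} {Y} X≈Y ]′ (oriented j)
    ; on-path  = λ p → on-path (P4-transport {X = Y} {X} (λ i j → ≡.sym (X≈Y i j)) p)
    }
    where open Good good

  bit : Graph n → Fin m → Bool
  bit X j = E X (a j) (b j)

  flip : Fin m → Graph n → Graph n
  flip j X = relabel X (b j) (c j)

  module _ (j : Fin m) where

    private
      τ = transpose (b j) (c j)

    τ-colour : ∀ i → K (τ i) ≡ K i
    τ-colour = transpose-elim (b j) (c j) (λ i i′ → K i′ ≡ K i)
      (trans (Kc j) (≡.sym (Kb j))) (trans (Kb j) (≡.sym (Kc j))) (λ _ _ _ → refl)

    τ-end : ∀ {i} → K i ≡ false → τ i ≡ i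
    τ-end Ki = transpose-fix (b j) (c j) (≢-colour K Ki (Kb j)) (≢-colour K Ki (Kc j))

    τ-b : ∀ {k} → k ≢ j → τ (b k) ≡ b k
    τ-b k≢j = transpose-fix (b j) (c j) (k≢j ∘ b-injective) b≢c

    τ-c : ∀ {k} → k ≢ j → τ (c k) ≡ c k
    τ-c k≢j = transpose-fix (b j) (c j) (b≢c ∘ ≡.sym) (k≢j ∘ c-injective)

    τ-pair : ∀ {y z p q} → SamePair (τ y) (τ z) p q → SamePair y z (τ p) (τ q)
    τ-pair {y} {z} (inj₁ (refl , refl)) = inj₁ (≡.sym (transpose-involutive (b j) (c j) y) , ≡.sym (transpose-involutive (b j) (c j) z))
    τ-pair {y} {z} (inj₂ (refl , refl)) = inj₂ (≡.sym (transpose-involutive (b j) (c j) y) , ≡.sym (transpose-involutive (b j) (c j) z))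

    τ-mids : ∀ {y z} k → SamePair (τ y) (τ z) (b k) (c k) → SamePair y z (b k) (c k)
    τ-mids {y} {z} k yz with k ≟ j
    ... | yes refl = SamePair-sym (subst₂ (SamePair y z) (transpose-l (b j) (c j)) (transpose-r (b j) (c j)) (τ-pair yz))
    ... | no k≢j   = subst₂ (SamePair y z) (τ-b k≢j) (τ-c k≢j) (τ-pair yz)

    module _ {X : Graph n} (good : Good X) where
      open Good good

      flip-good : Good (flip j X)
      flip-good = record { split-X = clique , independent ; oriented = oriented′ ; on-path = on-path′ }
        where
        clique : ∀ i i′ → i ≢ i′ → K i ≡ true → K i′ ≡ true → E X (τ i) (τ i′) ≡ true
        clique i i′ i≢i′ Ki Ki′ = proj₁ split-X (τ i) (τ i′)
          (λ e → i≢i′ (trans (≡.sym (transpose-involutive (b j) (c j) i)) (trans (cong τ e) (transpose-involutive (b j) (c j) i′))))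
          (trans (τ-colour i) Ki) (trans (τ-colour i′) Ki′)
        independent : ∀ i i′ → K i ≡ false → K i′ ≡ false → E X (τ i) (τ i′) ≡ false
        independent i i′ Ki Ki′ = proj₂ split-X (τ i) (τ i′) (trans (τ-colour i) Ki) (trans (τ-colour i′) Ki′)
        fixed : ∀ {x w} k → k ≢ j → K x ≡ false → K w ≡ false → InducedP4 X x (b k) (c k) w → InducedP4 (flip j X) x (b k) (c k) w
        fixed k k≢j Kx Kw p = P4-relabel X (b j) (c j)
          (P4-cong X (≡.sym (τ-end Kx)) (≡.sym (τ-b k≢j)) (≡.sym (τ-c k≢j)) (≡.sym (τ-end Kw)) p)
        reversed : ∀ {x w} → K x ≡ false → K w ≡ false → InducedP4 X x (b j) (c j) w → InducedP4 (flip j X) w (b j) (c j) x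
        reversed Kx Kw p = P4-relabel X (b j) (c j)
          (P4-cong X (≡.sym (τ-end Kw)) (≡.sym (transpose-l (b j) (c j))) (≡.sym (transpose-r (b j) (c j))) (≡.sym (τ-end Kx)) (P4-reverse X p))
        oriented′ : ∀ k → InducedP4 (flip j X) (a k) (b k) (c k) (d k) ⊎ InducedP4 (flip j X) (d k) (b k) (c k) (a k)
        oriented′ k with k ≟ j | oriented k
        ... | no k≢j   | inj₁ p = inj₁ (fixed k k≢j (Ka k) (Kd k) p)
        ... | no k≢j   | inj₂ p = inj₂ (fixed k k≢j (Kd k) (Ka k) p)
        ... | yes refl | inj₁ p = inj₂ (reversed (Ka k) (Kd k) p)
        ... | yes refl | inj₂ p = inj₁ (reversed (Kd k) (Ka k) p)
        on-path′ : ∀ {x y z w} → InducedP4 (flip j X) x y z w → ∃[ k ] OnPath k x y z w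
        on-path′ {x} {y} {z} {w} p with on-path (P4-unlabel X (b j) (c j) p)
        ... | k , yz , xw = k , τ-mids k yz , subst₂ (SamePair x w) (τ-end (Ka k)) (τ-end (Kd k)) (τ-pair xw)

      flip-switch : TwoSwitch X (flip j X)
      flip-switch with oriented j
      ... | inj₁ p = UniquePaths.relabel-switch X K split-X same-mid p
      ... | inj₂ p = UniquePaths.relabel-switch X K split-X same-mid p

      flip-bit : bit (flip j X) j ≡ not (bit X j)
      flip-bit = trans (cong₂ (E X) (τ-end (Ka j)) (transpose-l (b j) (c j))) (opposite (oriented j))
        where
        opposite : InducedP4 X (a j) (b j) (c j) (d j) ⊎ InducedP4 X (d j) (b j) (c j) (a j) →
          E X (a j) (c j) ≡ not (E X (a j) (b j))
        opposite (inj₁ (_ , (ab , _) , (ac , _))) rewrite ab | ac = refl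
        opposite (inj₂ (_ , (_ , _ , ca) , (_ , ba , _))) rewrite edge-sym X ca | edge-sym X ba = refl

      flip-other : ∀ {k} → k ≢ j → bit (flip j X) k ≡ bit X k
      flip-other {k} k≢j = cong₂ (E X) (τ-end (Ka k)) (τ-b k≢j)

  flip-realization : ∀ j (S : Realization deg-seq) → Good (graph S) → Realization deg-seq
  graph  (flip-realization j S good) = flip j (graph S)
  degree (flip-realization j S good) i =
    trans (≡.sym (TwoSwitch-deg (graph S) (flip j (graph S)) (flip-switch j good) i)) (degree S i)

  -- The bits are corrected one at a time; `flip-other` protects those already right.
  adjust : (v : Fin m → Bool) (js : List (Fin m)) →
    ∃[ S ] (Good (graph S) × (∀ j → j ∈ js → bit (graph {d = deg-seq} S) j ≡ v j))
  adjust v [] = R , good-G , λ _ ()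
  adjust v (j ∷ js) with adjust v js
  ... | S , good , agree with bit (graph S) j Bool.≟ v j
  ... | yes e = S , good , λ { _ (here refl) → e ; k (there k∈js) → agree k k∈js }
  ... | no ¬e = flip-realization j S good , flip-good j good , agree′
    where
    at-j : bit (flip j (graph S)) j ≡ v j
    at-j = trans (flip-bit j good) (≡.sym (Bool.¬-not (≢-sym ¬e)))
    agree′ : ∀ k → k ∈ j ∷ js → bit (flip j (graph S)) k ≡ v k
    agree′ k k∈ with k ≟ j
    ... | yes refl = at-j
    agree′ k (here k≡j)    | no k≢j = contradiction k≡j k≢j
    agree′ k (there k∈js) | no k≢j = trans (flip-other j good k≢j) (agree k k∈js)

  with-bits : (v : Fin m → Bool) → ∃[ S ] (Good (graph S) × (∀ j → bit (graph {d = deg-seq} S) j ≡ v j))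
  with-bits v with adjust v (allFin m)
  ... | S , good , agree = S , good , λ j → agree j (∈-allFin j)

  -- Only `S` has to be good: an opposite path is a path of `S`, hence lies on a listed one, and the
  -- bit of that index would differ. Of `T` only the degrees and the bits are used.
  bits-separate : ∀ (S T : Realization deg-seq) → Good (graph S) → (∀ j → bit (graph S) j ≡ bit (graph T) j) → S ≈R T
  bits-separate S T good same with UniquePaths.Compare.compare (graph S) K split-X same-mid (graph T)
      (same-split K G (graph T) split λ i → trans (degree R i) (≡.sym (degree T i)))
      (λ i → trans (degree S i) (≡.sym (degree T i)))
    where open Good good
  ... | inj₁ S≈T = S≈T
  ... | inj₂ (x , y , y′ , x′ , p@(_ , (xy , _ , y′x′) , (xy′ , yx′ , _)) , Txy , Txy′ , Tx′y′ , Tx′y)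
    with Good.on-path good p
  ... | j , inj₁ (refl , refl) , inj₁ (refl , refl) = ⊥-elim (true≢false (trans (≡.sym (same j)) xy) Txy)
  ... | j , inj₁ (refl , refl) , inj₂ (refl , refl) = ⊥-elim (true≢false Tx′y (trans (≡.sym (same j)) (edge-sym (graph S) yx′)))
  ... | j , inj₂ (refl , refl) , inj₁ (refl , refl) = ⊥-elim (true≢false Txy′ (trans (≡.sym (same j)) xy′))
  ... | j , inj₂ (refl , refl) , inj₂ (refl , refl) = ⊥-elim (true≢false (trans (≡.sym (same j)) (edge-sym (graph S) y′x′)) Tx′y′)

  -- Flips lead from `G` to a good realization with the bits of `S`, and `bits-separate`, with this
  -- one as its good argument, identifies it with `S`.
  all-good : ∀ (S : Realization deg-seq) → Good (graph S)
  all-good S with with-bits (bit (graph S))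
  ... | T , good , same = good-transport {graph T} {graph S} (bits-separate T S good same) good

  φ : Realization deg-seq → Vec Bool m
  φ S = tabulate (bit (graph S))

  φ-lookup : ∀ S j → lookup (φ S) j ≡ bit (graph S) j
  φ-lookup S = lookup∘tabulate (bit (graph S))

  φ-injective : ∀ S T → φ S ≡ φ T → S ≈R T
  φ-injective S T e = bits-separate S T (all-good S) λ j →
    trans (≡.sym (φ-lookup S j)) (trans (cong (λ v → lookup v j) e) (φ-lookup T j))

  φ-surjective : ∀ v → ∃[ S ] φ S ≡ v
  φ-surjective v with with-bits (lookup v)
  ... | S , _ , same = S , lookup-ext λ j → trans (φ-lookup S j) (same j)

  module _ (S T : Realization deg-seq) (good : Good (graph S)) where

    private
      X = graph S
      Y = graph T
      open Good good

    -- The switched vertices form an induced path, hence lie on listed path `j`. Its ends are `x`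
    -- and `x′`, so for `k ≢ j` the vertex `a k` takes no part in the switch and its bit stays.
    differ-end : ∀ {x y x′ y′} → SwitchAt X Y x y x′ y′ → K x ≡ false → DifferInOne (φ S) (φ T)
    differ-end {x} {y} {x′} {y′} ((x≢y , x≢x′ , x≢y′ , y≢x′ , y≢y′ , x′≢y′) , (xy , x′y′ , xy′ , yx′) , Yxy , Yx′y′ , Yxy′ , Yyx′ , same) Kx
      with on-path (P4InSplit.P4-from X K split-X Kx Ky Ky′ Kx′ xy xy′ (edge-sym X yx′) x′y′)
      where
      open P4InSplit X K split-X using (inside; outside)
      Ky  = inside (edge-sym X xy) Kx
      Kx′ = outside (≢-sym y≢x′) (edge-sym X yx′) Ky
      Ky′ = inside (edge-sym X x′y′) Kx′
    ... | j , mids , ends = j , changed mids ends , unchanged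
      where
      bits-≢ : bit X j ≢ bit Y j → lookup (φ S) j ≢ lookup (φ T) j
      bits-≢ ne e = ne (trans (≡.sym (φ-lookup S j)) (trans e (φ-lookup T j)))
      changed : SamePair y y′ (b j) (c j) → SamePair x x′ (a j) (d j) → lookup (φ S) j ≢ lookup (φ T) j
      changed (inj₁ (refl , refl)) (inj₁ (refl , refl)) = bits-≢ λ e → true≢false (trans (≡.sym e) xy) (Yxy _ _ (inj₁ (refl , refl)))
      changed (inj₁ (refl , refl)) (inj₂ (refl , refl)) = bits-≢ λ e → true≢false (Yyx′ _ _ (inj₂ (refl , refl))) (trans (≡.sym e) (edge-sym X yx′))
      changed (inj₂ (refl , refl)) (inj₁ (refl , refl)) = bits-≢ λ e → true≢false (Yxy′ _ _ (inj₁ (refl , refl))) (trans (≡.sym e) xy′)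
      changed (inj₂ (refl , refl)) (inj₂ (refl , refl)) = bits-≢ λ e → true≢false (trans (≡.sym e) x′y′) (Yx′y′ _ _ (inj₁ (refl , refl)))
      mid-≢ : ∀ {k z} → K z ≡ true → a k ≢ z
      mid-≢ Kz = ≢-colour K (Ka _) Kz
      K-mids : ∀ {y y′} → SamePair y y′ (b j) (c j) → K y ≡ true × K y′ ≡ true
      K-mids (inj₁ (refl , refl)) = Kb j , Kc j
      K-mids (inj₂ (refl , refl)) = Kc j , Kb j
      unchanged : ∀ k → k ≢ j → lookup (φ S) k ≡ lookup (φ T) k
      unchanged k k≢j = trans (φ-lookup S k) (trans (≡.sym (same (a k) (b k)
          (λ { (inj₁ (e , _)) → not-end (inj₁ e) ; (inj₂ (e , _)) → mid-≢ (proj₁ Kys) e })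
          (λ { (inj₁ (e , _)) → not-end (inj₂ e) ; (inj₂ (e , _)) → mid-≢ (proj₂ Kys) e })
          (λ { (inj₁ (e , _)) → not-end (inj₁ e) ; (inj₂ (e , _)) → mid-≢ (proj₂ Kys) e })
          (λ { (inj₁ (e , _)) → mid-≢ (proj₁ Kys) e ; (inj₂ (e , _)) → not-end (inj₂ e) })))
        (≡.sym (φ-lookup T k)))
        where
        Kys = K-mids mids
        not-end : ¬ (a k ≡ x ⊎ a k ≡ x′)
        not-end e = k≢j (end-index ends e)

    switch⇒differ : TwoSwitch X Y → DifferInOne (φ S) (φ T)
    switch⇒differ (x , y , x′ , y′ , sw@((_ , _ , x≢y′ , y≢x′ , _) , (_ , x′y′ , xy′ , yx′) , _)) = by-cases (K x Bool.≟ false)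
      where
      open P4InSplit X K split-X using (inside; outside)
      by-cases : Dec (K x ≡ false) → DifferInOne (φ S) (φ T)
      by-cases (yes Kx) = differ-end sw Kx
      -- Colours alternate around the switch: a clique vertex `x` makes `y′` independent, `x′` a
      -- clique vertex and `y` independent, so the reversed switch starts at an independent vertex.
      by-cases (no ¬Kx) = differ-end (SwitchAt-reverse X Y sw)
        (outside y≢x′ yx′ (inside x′y′ (outside (≢-sym x≢y′) (edge-sym X xy′) (not-false ¬Kx))))

    -- Flipping `S` at `j` produces the bits of `T`, hence `T` itself up to `≈R`.
    differ⇒switch : DifferInOne (φ S) (φ T) → TwoSwitch X Y
    differ⇒switch (j , ne , same) = TwoSwitch-transport {X = X} {flip j X} {Y}
      (bits-separate (flip-realization j S good) T (flip-good j good) bits) (flip-switch j good)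
      where
      at-j : bit Y j ≢ bit X j
      at-j e = ne (trans (φ-lookup S j) (trans (≡.sym e) (≡.sym (φ-lookup T j))))
      bits : ∀ k → bit (flip j X) k ≡ bit Y k
      bits k with k ≟ j
      ... | yes refl = trans (flip-bit j good) (≡.sym (Bool.¬-not at-j))
      ... | no k≢j   = trans (flip-other j good k≢j) (trans (≡.sym (φ-lookup S k)) (trans (same k k≢j) (φ-lookup T k)))

  adjacent⇒differ : ∀ S T → AdjR S T → DifferInOne (φ S) (φ T)
  adjacent⇒differ S T (inj₁ sw) = switch⇒differ S T (all-good S) sw
  adjacent⇒differ S T (inj₂ sw) = differ-sym {u = φ T} {φ S} (switch⇒differ T S (all-good T) sw)

  differ⇒adjacent : ∀ S T → DifferInOne (φ S) (φ T) → AdjR S T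
  differ⇒adjacent S T diff = inj₁ (differ⇒switch S T (all-good S) diff)

  hypercube : IsHypercube (Realization deg-seq) _≈R_ AdjR
  hypercube = m , φ , (λ S T S≈T → tabulate-cong λ j → S≈T (a j) (b j)) , φ-injective , φ-surjective ,
    λ S T → mk⇔ (adjacent⇒differ S T) (differ⇒adjacent S T)

theorem4p4 : (n : ℕ) (d : Vec ℕ n) → Graphic d →
    IsHypercube (Realization d) _≈R_ AdjR
    ⇔ (∃[ G ] (IsSplit (graph {d = d} G) × IsP4Reducible (graph G)))
theorem4p4 n d R = mk⇔ forward backward
  where
  reduce : IsHypercube (Realization d) _≈R_ AdjR → IsSplit (graph R) → ∃[ G ] (IsSplit (graph {d = d} G) × IsP4Reducible (graph G))
  -- The hypercube makes every realization split and P₄-reducible, so the given one serves as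
  -- witness.
  reduce cube (K , split) = R , (K , split) , hypercube-reducible cube R K split
  forward : IsHypercube (Realization d) _≈R_ AdjR → ∃[ G ] (IsSplit (graph {d = d} G) × IsP4Reducible (graph G))
  forward cube = reduce cube (hypercube-split cube R)
  backward : ∃[ G ] (IsSplit (graph {d = d} G) × IsP4Reducible (graph G)) → IsHypercube (Realization d) _≈R_ AdjR
  backward (G , (K , split) , red) = Converse.hypercube G K split red (pathList (graph G))
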